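{- Let $F^{(0)}_q(a)=1+\sum_{n\ge1}\frac{q^n}{(q;q)_n(aq;q)_{n-1}}$ (the generating function of $S_q$ by rise $a$ and area $q$) and $F^{(1)}_q(a)=1+\sum_{n\ge1}\frac{a^nq^{n^2}}{(q;q)_n(aq;q)_{n-1}}$ (the generating function of $F_q$ by width $a$ and area $q$). Set $R^{(0)}=S_q$, $R^{(1)}=F_q$. (i) For $N\ge0$ and $\sigma=(\sigma_0,\dots,\sigma_N)\in\{0,1\}^{N+1}$, the formal power series $$\xi_0^{\sigma}(q)=F^{(\sigma_0)}_q\circ F^{(\sigma_1)}_q\circ\dots\circ F^{(\sigma_N)}_q(0)$$ equals $\sum_T q^{A(T)}$, the sum over all ordered rooted trees $T$ of height at most $N$ in which every vertex at level $i$ is enriched by $R^{(\sigma_i)}$ (level $0$ being the root), with $A(T)$ the total area of the decorations. (ii) For every infinite sequence $\sigma=(\sigma_0,\sigma_1,\dots)\in\{0,1\}^{\mathbb N}$, the series $\xi_0(q)$ equals $\sum_T q^{A(T)}$, the sum over all finite ordered rooted trees $T$ in which every vertex at level $i$ is enriched by $R^{(\sigma_i)}$. In particular, for fixed total area $A$, the sets of such trees for any two choices of $\sigma\in\{0,1\}^{\mathbb N}$ are equinumerous.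
   Context: $\Theta_0(x,q)=\sum_{n=0}^\infty x^nq^{\binom n2}$; $\xi_0(q)$ is the unique formal power series in $q$ with $\Theta_0(-\xi_0(q),q)=0$. Notation: $(t;q)_n=\prod_{i=0}^{n-1}(1-tq^i)$. A stack polyomino is a finite unimodal sequence of positive integers $h_1\le\dots\le h_j<h_{j+1}\ge\dots\ge h_m$ ($m\ge1$, $0\le j\le m-1$), with rise $j$ and area $\sum_ih_i$; $S_q$ is the class of stack polyominoes plus an "empty polyomino" of rise $0$ and area $0$, with size of an element given by its rise. A Ferrers diagram is a finite weakly decreasing sequence of positive integers $m_1\ge\dots\ge m_h$ ($h\ge1$), with width $m_1$ and area $\sum_im_i$; $F_q$ is the class of Ferrers diagrams such that $m_n=n$ for some positive integer $n$ (the $n$-th largest row has length $n$), plus an "empty polyomino" of width $0$ and area $0$, with size given by width. A vertex with $d$ children "enriched by $R$" means it is decorated by an element of $R$ of size $d$. The level of a vertex is its distance from the root; the height of a tree is its maximal level. -}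

module Defs where

open import Data.Bool using (Bool; true; false)
open import Data.Nat as ℕ using (ℕ; zero; suc; _∸_; _≤_; _<_; _≥_; _⊔_; _≡ᵇ_)
open import Data.Nat.Combinatorics using (_C_)
open import Data.Integer as ℤ using (ℤ; +_; -_)
open import Data.Fin using (Fin; toℕ)
open import Data.List using (List; []; _∷_; length; lookup)
open import Data.Nat.ListAction using (sum)
open import Data.List.Relation.Unary.All using (All)
open import Data.List.Relation.Unary.Linked using (Linked)
open import Data.Maybe using (Maybe; just; nothing)
open import Data.Vec using (Vec; []; _∷_)
open import Data.Product using (Σ; ∃)
open import Relation.Binary.PropositionalEquality using (_≡_)

Series : Set
Series = ℕ → ℤ

sumTo : ℕ → (ℕ → ℤ) → ℤ
sumTo zero    f = + 0
sumTo (suc n) f = sumTo n f ℤ.+ f n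

0ˢ : Series
0ˢ _ = + 0

mono : ℕ → Series
mono k m with k ≡ᵇ m
... | true  = + 1
... | false = + 0

1ˢ : Series
1ˢ = mono 0

_+ˢ_ : Series → Series → Series
(f +ˢ g) m = f m ℤ.+ g m

-ˢ_ : Series → Series
(-ˢ f) m = - f m

_*ˢ_ : Series → Series → Series
(f *ˢ g) m = sumTo (suc m) (λ k → f k ℤ.* g (m ∸ k))

_^ˢ_ : Series → ℕ → Series
f ^ˢ zero  = 1ˢ
f ^ˢ suc n = (f ^ˢ n) *ˢ f

-- Σ_{n ≥ 0} t n, q-adically convergent sum.  Correct whenever the
-- series t n has q-adic valuation ≥ n ∸ 1 (then t n does not contribute
-- to the coefficient of q^m for n ≥ m + 2).
infSum : (ℕ → Series) → Series
infSum t m = sumTo (suc (suc m)) (λ n → t n m)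

-- geometric series 1/(1 - h) = Σ_k h^k, correct whenever h has zero
-- constant term (then h^k has valuation ≥ k).
geo : Series → Series
geo h m = sumTo (suc m) (λ k → (h ^ˢ k) m)

prod1 : ℕ → (ℕ → Series) → Series
prod1 zero    s = 1ˢ
prod1 (suc n) s = prod1 n s *ˢ s (suc n)

invQPoch : ℕ → Series
invQPoch n = prod1 n (λ i → geo (mono i))

invAQPoch : Series → ℕ → Series
invAQPoch G n = prod1 n (λ i → geo (mono i *ˢ G))

termF : Bool → Series → ℕ → Series
termF false G n = (mono n *ˢ invQPoch n) *ˢ invAQPoch G (n ∸ 1)
termF true  G n = (((G ^ˢ n) *ˢ mono (n ℕ.* n)) *ˢ invQPoch n) *ˢ invAQPoch G (n ∸ 1)

Fq : Bool → Series → Series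
Fq σ G = 1ˢ +ˢ infSum summand
  where
  summand : ℕ → Series
  summand zero    = 0ˢ
  summand (suc n) = termF σ G (suc n)

compose : (ℕ → Bool) → ℕ → Series → Series
compose σ zero    x = Fq (σ 0) x
compose σ (suc N) x = Fq (σ 0) (compose (λ i → σ (suc i)) N x)

xiSigma : (ℕ → Bool) → ℕ → Series
xiSigma σ N = compose σ N 0ˢ

thetaNeg : Series → Series
thetaNeg ξ = infSum (λ n → ((-ˢ ξ) ^ˢ n) *ˢ mono (n C 2))

IsXi0 : Series → Set
IsXi0 ξ = ∀ m → thetaNeg ξ m ≡ + 0

-- Stack polyominoes: h_1 ≤ … ≤ h_j < h_{j+1} ≥ … ≥ h_m, all positive,
-- stored as left = (h_1,…,h_j), peak = h_{j+1}, right = (h_{j+2},…,h_m).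

record Stack : Set where
  field
    left      : List ℕ
    peak      : ℕ
    right     : List ℕ
    left-pos  : All (0 <_) left
    peak-pos  : 0 < peak
    right-pos : All (0 <_) right
    left-inc  : Linked _≤_ left
    left-lt   : All (_< peak) left
    right-dec : Linked _≥_ (peak ∷ right)

rise : Stack → ℕ
rise s = length (Stack.left s)

stackArea : Stack → ℕ
stackArea s = sum (Stack.left s) ℕ.+ Stack.peak s ℕ.+ sum (Stack.right s)

record Ferrers : Set where
  field
    rows     : List ℕ
    nonempty : 0 < length rows
    pos      : All (0 <_) rows
    dec      : Linked _≥_ rows
    durfee   : ∃ λ (i : Fin (length rows)) → lookup rows i ≡ suc (toℕ i)

width : Ferrers → ℕ
width f with Ferrers.rows f
... | []    = 0
... | x ∷ _ = x

ferrersArea : Ferrers → ℕ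
ferrersArea f = sum (Ferrers.rows f)

-- The classes R^(0) = S_q and R^(1) = F_q (nothing = empty polyomino).

Obj : Bool → Set
Obj false = Maybe Stack
Obj true  = Maybe Ferrers

size : (b : Bool) → Obj b → ℕ
size false nothing  = 0
size false (just s) = rise s
size true  nothing  = 0
size true  (just f) = width f

objArea : (b : Bool) → Obj b → ℕ
objArea false nothing  = 0
objArea false (just s) = stackArea s
objArea true  nothing  = 0
objArea true  (just f) = ferrersArea f

-- Ordered rooted trees, a vertex at level ℓ with d children being
-- enriched by an element of R^(σ ℓ) of size d.  Tree σ 0 = trees whose
-- root is at level 0.

data Tree (σ : ℕ → Bool) : ℕ → Set where
  node : ∀ {ℓ} (r : Obj (σ ℓ)) → Vec (Tree σ (suc ℓ)) (size (σ ℓ) r) → Tree σ ℓ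

mutual
  height : ∀ {σ ℓ} → Tree σ ℓ → ℕ
  height (node r ts) = heightV ts

  heightV : ∀ {σ ℓ n} → Vec (Tree σ ℓ) n → ℕ
  heightV []       = 0
  heightV (t ∷ ts) = suc (height t) ⊔ heightV ts

mutual
  area : ∀ {σ ℓ} → Tree σ ℓ → ℕ
  area {σ} {ℓ} (node r ts) = objArea (σ ℓ) r ℕ.+ areaV ts

  areaV : ∀ {σ ℓ n} → Vec (Tree σ ℓ) n → ℕ
  areaV []       = 0
  areaV (t ∷ ts) = area t ℕ.+ areaV ts

{-# OPTIONS --safe #-}
module Submission where

-- Write Θ(a) = Σ (-a)ⁿ q^{n(n-1)/2}, so that Θ(a) = 1 - a Θ(aq), and this equation determines Θ.
-- Two other expressions satisfy it: (q;q)_∞ (aq;q)_∞ (F⁽⁰⁾(a) - a), by summation by parts, and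
-- (aq;q)_∞ (F⁽¹⁾(a) - a), by the Durfee square identity.  As the infinite products are units, the
-- equations Θ(ξ) = 0, F⁽⁰⁾(ξ) = ξ and F⁽¹⁾(ξ) = ξ are equivalent.  Both F⁽⁰⁾ and F⁽¹⁾ are q-adic
-- contractions, so the root ξ₀ agrees modulo q^{N+1} with the composite of any N + 1 of them at 0.
-- That composite counts the trees of height at most N, and the height of a tree is at most its area.

open import Defs
  renaming (_+ˢ_ to infixl 6 _+ˢ_; _*ˢ_ to infixl 7 _*ˢ_; -ˢ_ to infix 8 -ˢ_; _^ˢ_ to infixr 9 _^ˢ_)
open import Algebra.Bundles using (CommutativeRing)
open import Algebra.Solver.Ring.AlmostCommutativeRing
  using (fromCommutativeRing; _-Raw-AlmostCommutative⟶_)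
import Algebra.Solver.Ring
open import Data.Bool using (Bool; true; false; T)
open import Data.Empty using (⊥-elim)
open import Data.Fin using (Fin; toℕ; zero; suc)
import Data.Fin.Properties as Fin
open import Data.Integer as ℤ using (ℤ; +_; -_; 0ℤ; 1ℤ)
import Data.Integer.Properties as ℤ
open import Data.Integer.Tactic.RingSolver using (solve-∀)
open import Data.List using (List; []; _∷_; length; lookup)
open import Data.List.Relation.Unary.All as All using (All; []; _∷_)
open import Data.List.Relation.Unary.Linked as Linked using (Linked; []; [-]; _∷_)
open import Data.Maybe as Maybe using (just; nothing)
open import Data.Nat as ℕ using (ℕ; zero; suc; _≤_; _<_; _≥_; _∸_; z≤n; s≤s; z<s; _≡ᵇ_)
open import Data.Nat.Combinatorics using (_C_; nCk+nC[k+1]≡[n+1]C[k+1]; nC1≡n)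
open import Data.Nat.Induction using (<-rec)
open import Data.Nat.ListAction using (sum)
import Data.Nat.Properties as ℕ
open import Data.Nat.Tactic.RingSolver using () renaming (solve-∀ to solveℕ-∀)
open import Data.Product using (Σ; ∃; _×_; _,_; proj₁; proj₂)
open import Data.Product.Function.NonDependent.Propositional using (_×-↔_)
open import Data.Sum using (_⊎_; inj₁; inj₂; [_,_]′)
open import Data.Sum.Function.Propositional using (_⊎-↔_)
open import Data.Unit using (⊤; tt)
open import Data.Vec using (Vec; []; _∷_)
open import Function using (_∘_; _↔_; mk↔ₛ′; Inverse)
open import Function.Properties.Inverse using (↔-sym; ↔-trans)
open import Relation.Binary using (Setoid)
open import Relation.Binary.PropositionalEquality
  using (_≡_; refl; sym; trans; cong; cong₂; subst; module ≡-Reasoning)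
import Relation.Binary.Reasoning.Setoid as SetoidReasoning
open import Relation.Nullary using (yes; no; ¬_)
open import Relation.Nullary.Decidable using (dec⇒maybe)

-- Formal power series as a commutative ring

-- No infinite product is ever formed. Both identities are proved for N terms after multiplication
-- by a finite product, as exact identities with an explicit error. The functional equation then
-- relates N + 1 terms at a to N terms at aq: each step loses a term, but the argument gains a
-- factor q. The number of terms plus the order of the argument stays constant, which is why the
-- divisibility of a is tracked although the final identity holds for arbitrary a. On the
-- combinatorial side, substituting G for a is never a separate operation. Children travel with the
-- columns they are attached to, and a peeled column takes its child along, so that the geometric
-- series in q^i G arises directly.

sumTo-cong : ∀ n {f g : ℕ → ℤ} → (∀ i → i < n → f i ≡ g i) → sumTo n f ≡ sumTo n g
sumTo-cong zero    e = refl
sumTo-cong (suc n) e =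
  cong₂ ℤ._+_ (sumTo-cong n (λ i i<n → e i (ℕ.m<n⇒m<1+n i<n))) (e n ℕ.≤-refl)

sumTo-zero : ∀ n {f : ℕ → ℤ} → (∀ i → i < n → f i ≡ 0ℤ) → sumTo n f ≡ 0ℤ
sumTo-zero zero    e = refl
sumTo-zero (suc n) e
  rewrite sumTo-zero n (λ i i<n → e i (ℕ.m<n⇒m<1+n i<n)) | e n ℕ.≤-refl = refl

sumTo-+ : ∀ n (f g : ℕ → ℤ) → sumTo n (λ i → f i ℤ.+ g i) ≡ sumTo n f ℤ.+ sumTo n g
sumTo-+ zero    f g = refl
sumTo-+ (suc n) f g rewrite sumTo-+ n f g =
  lem (sumTo n f) (sumTo n g) (f n) (g n)
  where
  lem : ∀ a b c d → (a ℤ.+ b) ℤ.+ (c ℤ.+ d) ≡ (a ℤ.+ c) ℤ.+ (b ℤ.+ d)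
  lem = solve-∀

sumTo-*ˡ : ∀ n c (f : ℕ → ℤ) → sumTo n (λ i → c ℤ.* f i) ≡ c ℤ.* sumTo n f
sumTo-*ˡ zero    c f = sym (ℤ.*-zeroʳ c)
sumTo-*ˡ (suc n) c f rewrite sumTo-*ˡ n c f = sym (ℤ.*-distribˡ-+ c (sumTo n f) (f n))

sumTo-front : ∀ n (f : ℕ → ℤ) → sumTo (suc n) f ≡ f 0 ℤ.+ sumTo n (f ∘ suc)
sumTo-front zero    f = ℤ.+-comm 0ℤ (f 0)
sumTo-front (suc n) f rewrite sumTo-front n f =
  ℤ.+-assoc (f 0) (sumTo n (f ∘ suc)) (f (suc n))

sumTo-extend : ∀ {n N} (f : ℕ → ℤ) → n ≤ N → (∀ i → n ≤ i → i < N → f i ≡ 0ℤ) →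
               sumTo N f ≡ sumTo n f
sumTo-extend {n} {N} f n≤N z with ℕ.m≤n⇒∃[o]m+o≡n n≤N
... | d , refl = go d (λ i n≤i i<n+d → z i n≤i i<n+d)
  where
  go : ∀ d → (∀ i → n ≤ i → i < n ℕ.+ d → f i ≡ 0ℤ) → sumTo (n ℕ.+ d) f ≡ sumTo n f
  go zero    z rewrite ℕ.+-identityʳ n = refl
  go (suc d) z rewrite ℕ.+-suc n d
    | z (n ℕ.+ d) (ℕ.m≤m+n n d) ℕ.≤-refl
    | ℤ.+-identityʳ (sumTo (n ℕ.+ d) f) = go d (λ i n≤i i<m → z i n≤i (ℕ.m<n⇒m<1+n i<m))

infix 4 _≈_ _≈[_]_

-- Records rather than plain function types, so that both sides can be inferred.
record _≈_ (f g : Series) : Set where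
  constructor ptw
  field at : ∀ m → f m ≡ g m
open _≈_

record _≈[_]_ (f : Series) (M : ℕ) (g : Series) : Set where
  constructor mod
  field below : ∀ m → m < M → f m ≡ g m
open _≈[_]_

≈-refl : ∀ {f} → f ≈ f
≈-refl = ptw λ _ → refl

≈-sym : ∀ {f g} → f ≈ g → g ≈ f
≈-sym p = ptw λ m → sym (at p m)

≈-trans : ∀ {f g h} → f ≈ g → g ≈ h → f ≈ h
≈-trans p q = ptw λ m → trans (at p m) (at q m)

+ˢ-cong : ∀ {f f′ g g′} → f ≈ f′ → g ≈ g′ → f +ˢ g ≈ f′ +ˢ g′
+ˢ-cong p q = ptw λ m → cong₂ ℤ._+_ (at p m) (at q m)

-ˢ-cong : ∀ {f g} → f ≈ g → -ˢ f ≈ -ˢ g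
-ˢ-cong p = ptw λ m → cong -_ (at p m)

*ˢ-cong-mod : ∀ {M f f′ g g′} → f ≈[ M ] f′ → g ≈[ M ] g′ → f *ˢ g ≈[ M ] f′ *ˢ g′
*ˢ-cong-mod p q = mod λ m m<M → sumTo-cong (suc m) λ k k<1+m →
  cong₂ ℤ._*_ (below p k (ℕ.<-≤-trans k<1+m m<M))
              (below q (m ∸ k) (ℕ.≤-<-trans (ℕ.m∸n≤m m k) m<M))

≈⇒mod : ∀ {M f g} → f ≈ g → f ≈[ M ] g
≈⇒mod p = mod λ m _ → at p m

mod⇒≈ : ∀ {f g} → (∀ M → f ≈[ M ] g) → f ≈ g
mod⇒≈ p = ptw λ m → below (p (suc m)) m ℕ.≤-refl

*ˢ-cong : ∀ {f f′ g g′} → f ≈ f′ → g ≈ g′ → f *ˢ g ≈ f′ *ˢ g′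
*ˢ-cong p q = mod⇒≈ λ M → *ˢ-cong-mod (≈⇒mod p) (≈⇒mod q)

shift : Series → Series
shift f m = f (suc m)

scale : ℤ → Series → Series
scale c f m = c ℤ.* f m

*ˢ-front : ∀ f g m → (f *ˢ g) (suc m) ≡ f 0 ℤ.* g (suc m) ℤ.+ (shift f *ˢ g) m
*ˢ-front f g m = sumTo-front (suc m) (λ k → f k ℤ.* g (suc m ∸ k))

*ˢ-back : ∀ f g m → (f *ˢ g) (suc m) ≡ (f *ˢ shift g) m ℤ.+ f (suc m) ℤ.* g 0
*ˢ-back f g m = cong₂ ℤ._+_
  (sumTo-cong (suc m) λ k k<1+m →
    cong (λ i → f k ℤ.* g i) (ℕ.+-∸-assoc 1 (ℕ.≤-pred k<1+m)))
  (cong (λ i → f (suc m) ℤ.* g i) (ℕ.n∸n≡0 m))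

-- Induction on the coefficient: one product loses its first summand, the other its last, and the
-- remainders are products with a shifted series. No sum has to be reindexed.
*ˢ-comm′ : ∀ m f g → (f *ˢ g) m ≡ (g *ˢ f) m
*ˢ-comm′ zero    f g = cong₂ ℤ._+_ {x = 0ℤ} refl (ℤ.*-comm (f 0) (g 0))
*ˢ-comm′ (suc m) f g = begin
  (f *ˢ g) (suc m)                              ≡⟨ *ˢ-front f g m ⟩
  f 0 ℤ.* g (suc m) ℤ.+ (shift f *ˢ g) m        ≡⟨ cong₂ ℤ._+_ (ℤ.*-comm (f 0) _) (*ˢ-comm′ m (shift f) g) ⟩
  g (suc m) ℤ.* f 0 ℤ.+ (g *ˢ shift f) m        ≡⟨ ℤ.+-comm (g (suc m) ℤ.* f 0) _ ⟩
  (g *ˢ shift f) m ℤ.+ g (suc m) ℤ.* f 0        ≡⟨ *ˢ-back g f m ⟨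
  (g *ˢ f) (suc m)                              ∎
  where open ≡-Reasoning

*ˢ-comm : ∀ f g → f *ˢ g ≈ g *ˢ f
*ˢ-comm f g = ptw λ m → *ˢ-comm′ m f g

*ˢ-distribʳ : ∀ f g h → (g +ˢ h) *ˢ f ≈ (g *ˢ f) +ˢ (h *ˢ f)
*ˢ-distribʳ f g h = ptw λ m → trans
  (sumTo-cong (suc m) λ k _ → ℤ.*-distribʳ-+ (f (m ∸ k)) (g k) (h k))
  (sumTo-+ (suc m) _ _)

scale-*ˢ : ∀ c f g → scale c f *ˢ g ≈ scale c (f *ˢ g)
scale-*ˢ c f g = ptw λ m → trans
  (sumTo-cong (suc m) λ k _ → ℤ.*-assoc c (f k) (g (m ∸ k)))
  (sumTo-*ˡ (suc m) c _)

-- The same induction avoids double sums: the shift of f g is f(0) times the shift of g, plus the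
-- product of the shift of f with g.
*ˢ-assoc′ : ∀ m f g h → ((f *ˢ g) *ˢ h) m ≡ (f *ˢ (g *ˢ h)) m
*ˢ-assoc′ zero    f g h = lem (f 0) (g 0) (h 0)
  where
  lem : ∀ a b c → 0ℤ ℤ.+ (0ℤ ℤ.+ a ℤ.* b) ℤ.* c ≡ 0ℤ ℤ.+ a ℤ.* (0ℤ ℤ.+ b ℤ.* c)
  lem = solve-∀
*ˢ-assoc′ (suc m) f g h = begin
  ((f *ˢ g) *ˢ h) (suc m)
    ≡⟨ *ˢ-front (f *ˢ g) h m ⟩
  (f *ˢ g) 0 ℤ.* h (suc m) ℤ.+ (shift (f *ˢ g) *ˢ h) m
    ≡⟨ cong (λ z → (f *ˢ g) 0 ℤ.* h (suc m) ℤ.+ z) (at (*ˢ-cong {shift (f *ˢ g)} (ptw (*ˢ-front f g)) (≈-refl {h})) m) ⟩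
  (f *ˢ g) 0 ℤ.* h (suc m) ℤ.+ ((scale (f 0) (shift g) +ˢ (shift f *ˢ g)) *ˢ h) m
    ≡⟨ cong (λ z → (f *ˢ g) 0 ℤ.* h (suc m) ℤ.+ z) (at (*ˢ-distribʳ h (scale (f 0) (shift g)) (shift f *ˢ g)) m) ⟩
  (f *ˢ g) 0 ℤ.* h (suc m) ℤ.+ ((scale (f 0) (shift g) *ˢ h) m ℤ.+ ((shift f *ˢ g) *ˢ h) m)
    ≡⟨ cong (λ z → (f *ˢ g) 0 ℤ.* h (suc m) ℤ.+ z) (cong₂ ℤ._+_ (at (scale-*ˢ (f 0) (shift g) h) m) (*ˢ-assoc′ m (shift f) g h)) ⟩
  (f *ˢ g) 0 ℤ.* h (suc m) ℤ.+ (f 0 ℤ.* (shift g *ˢ h) m ℤ.+ (shift f *ˢ (g *ˢ h)) m)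
    ≡⟨ lem (f 0) (g 0) (h (suc m)) _ _ ⟩
  f 0 ℤ.* (g 0 ℤ.* h (suc m) ℤ.+ (shift g *ˢ h) m) ℤ.+ (shift f *ˢ (g *ˢ h)) m
    ≡⟨ cong (λ z → f 0 ℤ.* z ℤ.+ (shift f *ˢ (g *ˢ h)) m) (*ˢ-front g h m) ⟨
  f 0 ℤ.* (g *ˢ h) (suc m) ℤ.+ (shift f *ˢ (g *ˢ h)) m
    ≡⟨ *ˢ-front f (g *ˢ h) m ⟨
  (f *ˢ (g *ˢ h)) (suc m) ∎
  where
  open ≡-Reasoning
  lem : ∀ a b c x y → (0ℤ ℤ.+ a ℤ.* b) ℤ.* c ℤ.+ (a ℤ.* x ℤ.+ y) ≡ a ℤ.* (b ℤ.* c ℤ.+ x) ℤ.+ y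
  lem = solve-∀

const : ℤ → Series
const c zero    = c
const c (suc m) = 0ℤ

1ˢ≈const : 1ˢ ≈ const 1ℤ
1ˢ≈const = ptw λ { zero → refl ; (suc m) → refl }

0ˢ≈const : 0ˢ ≈ const 0ℤ
0ˢ≈const = ptw λ { zero → refl ; (suc m) → refl }

const-* : ∀ c f → const c *ˢ f ≈ scale c f
const-* c f = ptw λ m → trans (sumTo-front m _) (trans
  (cong₂ ℤ._+_ {x = c ℤ.* f m} refl (sumTo-zero m λ i _ → refl)) (ℤ.+-identityʳ _))

*ˢ-identityˡ : ∀ f → 1ˢ *ˢ f ≈ f
*ˢ-identityˡ f = ≈-trans (*ˢ-cong 1ˢ≈const (≈-refl {f}))
  (≈-trans (const-* 1ℤ f) (ptw λ m → ℤ.*-identityˡ (f m)))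

seriesRing : CommutativeRing _ _
seriesRing = record
  { Carrier = Series ; _≈_ = _≈_ ; _+_ = _+ˢ_ ; _*_ = _*ˢ_ ; -_ = -ˢ_ ; 0# = 0ˢ ; 1# = 1ˢ
  ; isCommutativeRing = record
    { isRing = record
      { +-isAbelianGroup = record
        { isGroup = record
          { isMonoid = record
            { isSemigroup = record
              { isMagma = record
                { isEquivalence = record { refl = ≈-refl ; sym = ≈-sym ; trans = ≈-trans }
                ; ∙-cong = +ˢ-cong }
              ; assoc = λ f g h → ptw λ m → ℤ.+-assoc (f m) (g m) (h m) }
            ; identity = (λ f → ptw λ m → ℤ.+-identityˡ (f m)) , (λ f → ptw λ m → ℤ.+-identityʳ (f m)) }
          ; inverse = (λ f → ptw λ m → ℤ.+-inverseˡ (f m)) , (λ f → ptw λ m → ℤ.+-inverseʳ (f m))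
          ; ⁻¹-cong = -ˢ-cong }
        ; comm = λ f g → ptw λ m → ℤ.+-comm (f m) (g m) }
      ; *-cong = *ˢ-cong
      ; *-assoc = λ f g h → ptw λ m → *ˢ-assoc′ m f g h
      ; *-identity = *ˢ-identityˡ , λ f → ≈-trans (*ˢ-comm f 1ˢ) (*ˢ-identityˡ f)
      ; distrib = (λ f g h → ≈-trans (*ˢ-comm f (g +ˢ h)) (≈-trans (*ˢ-distribʳ f g h)
                    (+ˢ-cong (*ˢ-comm g f) (*ˢ-comm h f)))) , *ˢ-distribʳ }
    ; *-comm = *ˢ-comm } }

module S = CommutativeRing seriesRing

private
  -- The literals 0 and 1 denote 0ˢ and 1ˢ definitionally, as the solver needs.
  ι : ℤ → Series
  ι (+ 0)     = 0ˢ
  ι (+ 1)     = 1ˢ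
  ι c         = const c

  ι≈const : ∀ c → ι c ≈ const c
  ι≈const (+ 0)           = 0ˢ≈const
  ι≈const (+ 1)           = 1ˢ≈const
  ι≈const (+ suc (suc _)) = ≈-refl
  ι≈const ℤ.-[1+ _ ]      = ≈-refl

  ℤ⟶Series : CommutativeRing.rawRing ℤ.+-*-commutativeRing
             -Raw-AlmostCommutative⟶ fromCommutativeRing seriesRing
  ℤ⟶Series = record
    { ⟦_⟧    = ι
    ; +-homo = λ c d → ≈-trans (ι≈const (c ℤ.+ d)) (≈-trans (ptw λ { zero → refl ; (suc m) → refl })
        (≈-sym (+ˢ-cong (ι≈const c) (ι≈const d))))
    ; *-homo = λ c d → ≈-trans (ι≈const (c ℤ.* d)) (≈-sym (≈-trans (*ˢ-cong (ι≈const c) (ι≈const d))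
        (≈-trans (const-* c (const d)) (ptw λ { zero → refl ; (suc m) → ℤ.*-zeroʳ c }))))
    ; -‿homo = λ c → ≈-trans (ι≈const (- c)) (≈-trans (ptw λ { zero → refl ; (suc m) → refl })
        (≈-sym (-ˢ-cong (ι≈const c))))
    ; 0-homo = ≈-refl
    ; 1-homo = ≈-refl
    }

  ι-≟ : ∀ c d → Maybe.Maybe (ι c ≈ ι d)
  ι-≟ c d = Maybe.map (λ { refl → ≈-refl }) (dec⇒maybe (c ℤ.≟ d))

module Solver = Algebra.Solver.Ring _ _ ℤ⟶Series ι-≟
open Solver using (solve; _:+_; _:*_; _:-_; :-_; con; _:=_)

-- Congruence modulo powers of q

mod-refl : ∀ {M f} → f ≈[ M ] f
mod-refl = mod λ _ _ → refl

mod-sym : ∀ {M f g} → f ≈[ M ] g → g ≈[ M ] f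
mod-sym p = mod λ m m<M → sym (below p m m<M)

mod-trans : ∀ {M f g h} → f ≈[ M ] g → g ≈[ M ] h → f ≈[ M ] h
mod-trans p q = mod λ m m<M → trans (below p m m<M) (below q m m<M)

modSetoid : ℕ → Setoid _ _
modSetoid M = record
  { Carrier = Series ; _≈_ = _≈[ M ]_
  ; isEquivalence = record { refl = mod-refl ; sym = mod-sym ; trans = mod-trans } }

module ModReasoning (M : ℕ) = SetoidReasoning (modSetoid M)

mod-weaken : ∀ {L M f g} → L ≤ M → f ≈[ M ] g → f ≈[ L ] g
mod-weaken L≤M p = mod λ m m<L → below p m (ℕ.<-≤-trans m<L L≤M)

+ˢ-cong-mod : ∀ {M f f′ g g′} → f ≈[ M ] f′ → g ≈[ M ] g′ → f +ˢ g ≈[ M ] f′ +ˢ g′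
+ˢ-cong-mod p q = mod λ m m<M → cong₂ ℤ._+_ (below p m m<M) (below q m m<M)

-ˢ-cong-mod : ∀ {M f g} → f ≈[ M ] g → -ˢ f ≈[ M ] -ˢ g
-ˢ-cong-mod p = mod λ m m<M → cong -_ (below p m m<M)

^ˢ-cong-mod : ∀ {M f g} n → f ≈[ M ] g → f ^ˢ n ≈[ M ] g ^ˢ n
^ˢ-cong-mod zero    p = mod-refl
^ˢ-cong-mod (suc n) p = *ˢ-cong-mod (^ˢ-cong-mod n p) p

-- f ≈[ M ] 0ˢ says that f is divisible by q^M.
*ˢ-vanish : ∀ {K L f g} → f ≈[ K ] 0ˢ → g ≈[ L ] 0ˢ → f *ˢ g ≈[ K ℕ.+ L ] 0ˢ
*ˢ-vanish {K} {L} {f} {g} p q = mod λ m m<K+L → sumTo-zero (suc m) (term m m<K+L)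
  where
  term : ∀ m → m < K ℕ.+ L → ∀ k → k < suc m → f k ℤ.* g (m ∸ k) ≡ 0ℤ
  term m m<K+L k k≤m with k ℕ.<? K
  ... | yes k<K rewrite below p k k<K = refl
  ... | no  k≮K rewrite below q (m ∸ k) (ℕ.+-cancelˡ-< k _ _ (subst (_< k ℕ.+ L)
            (sym (ℕ.m+[n∸m]≡n (ℕ.≤-pred k≤m)))
            (ℕ.<-≤-trans m<K+L (ℕ.+-monoˡ-≤ L (ℕ.≮⇒≥ k≮K))))) = ℤ.*-zeroʳ (f k)

vanish-0 : ∀ {f} → f ≈[ 0 ] 0ˢ
vanish-0 = mod λ _ ()

*ˢ-vanishˡ : ∀ {M f g} → f ≈[ M ] 0ˢ → f *ˢ g ≈[ M ] 0ˢ
*ˢ-vanishˡ {M} {f} {g} p =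
  subst (λ K → f *ˢ g ≈[ K ] 0ˢ) (ℕ.+-identityʳ M) (*ˢ-vanish {g = g} p vanish-0)

*ˢ-vanishʳ : ∀ {M f g} → g ≈[ M ] 0ˢ → f *ˢ g ≈[ M ] 0ˢ
*ˢ-vanishʳ {f = f} = *ˢ-vanish {f = f} vanish-0

^ˢ-vanish : ∀ {f} n → f ≈[ 1 ] 0ˢ → f ^ˢ n ≈[ n ] 0ˢ
^ˢ-vanish zero    p = vanish-0
^ˢ-vanish {f} (suc n) p =
  subst (λ K → f ^ˢ suc n ≈[ K ] 0ˢ) (ℕ.+-comm n 1) (*ˢ-vanish (^ˢ-vanish n p) p)

-- The difference is h (f - g), so the two orders add up. This gain is the source of the contraction
-- property of `Fq`.
*ˢ-cong-modʳ : ∀ {K L f g h} → h ≈[ K ] 0ˢ → f ≈[ L ] g → h *ˢ f ≈[ K ℕ.+ L ] h *ˢ g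
*ˢ-cong-modʳ {K} {L} {f} {g} {h} v p = begin
  h *ˢ f                          ≈⟨ ≈⇒mod (solve 3 (λ f g h → h :* f := h :* (f :+ :- g) :+ h :* g) ≈-refl f g h) ⟩
  h *ˢ (f +ˢ -ˢ g) +ˢ h *ˢ g      ≈⟨ +ˢ-cong-mod (*ˢ-vanish v d) mod-refl ⟩
  0ˢ +ˢ h *ˢ g                    ≈⟨ ≈⇒mod (S.+-identityˡ (h *ˢ g)) ⟩
  h *ˢ g                          ∎
  where
  open ModReasoning (K ℕ.+ L)
  d : f +ˢ -ˢ g ≈[ L ] 0ˢ
  d = mod-trans (+ˢ-cong-mod p mod-refl) (≈⇒mod (S.-‿inverseʳ g))

mono-shift : ∀ k m → mono (suc k) (suc m) ≡ mono k m
mono-shift k m with k ≡ᵇ m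
... | true  = refl
... | false = refl

mono-*-suc : ∀ k f m → (mono (suc k) *ˢ f) (suc m) ≡ (mono k *ˢ f) m
mono-*-suc k f m = trans (*ˢ-front (mono (suc k)) f m)
  (trans (ℤ.+-identityˡ _) (at (*ˢ-cong (ptw (mono-shift k)) (≈-refl {f})) m))

mono-+ : ∀ j k → mono (j ℕ.+ k) ≈ mono j *ˢ mono k
mono-+ zero    k = ≈-sym (*ˢ-identityˡ (mono k))
mono-+ (suc j) k = ptw λ
  { zero    → refl
  ; (suc m) → trans (mono-shift (j ℕ.+ k) m)
      (trans (at (mono-+ j k) m) (sym (mono-*-suc j (mono k) m))) }

mono-vanish : ∀ k → mono k ≈[ k ] 0ˢ
mono-vanish k = mod (go k)
  where
  go : ∀ k m → m < k → mono k m ≡ 0ℤ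
  go (suc k) zero    _   = refl
  go (suc k) (suc m) m<k = trans (mono-shift k m) (go k m (ℕ.≤-pred m<k))

sumˢ : ℕ → (ℕ → Series) → Series
sumˢ n t m = sumTo n (λ i → t i m)

*ˢ-sumˢ : ∀ n f t → f *ˢ sumˢ n t ≈ sumˢ n (λ i → f *ˢ t i)
*ˢ-sumˢ zero    f t = ptw λ m → sumTo-zero (suc m) λ k _ → ℤ.*-zeroʳ (f k)
*ˢ-sumˢ (suc n) f t = ≈-trans (S.distribˡ f (sumˢ n t) (t n)) (+ˢ-cong (*ˢ-sumˢ n f t) (≈-refl {f *ˢ t n}))

geo-partial : ∀ h n → (1ˢ +ˢ -ˢ h) *ˢ sumˢ n (h ^ˢ_) ≈ 1ˢ +ˢ -ˢ (h ^ˢ n)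
geo-partial h zero    = ≈-trans (*ˢ-sumˢ 0 (1ˢ +ˢ -ˢ h) (h ^ˢ_)) (≈-sym (S.-‿inverseʳ 1ˢ))
geo-partial h (suc n) = begin
  (1ˢ +ˢ -ˢ h) *ˢ (sumˢ n (h ^ˢ_) +ˢ h ^ˢ n)
    ≈⟨ S.distribˡ (1ˢ +ˢ -ˢ h) (sumˢ n (h ^ˢ_)) (h ^ˢ n) ⟩
  (1ˢ +ˢ -ˢ h) *ˢ sumˢ n (h ^ˢ_) +ˢ (1ˢ +ˢ -ˢ h) *ˢ h ^ˢ n
    ≈⟨ +ˢ-cong (geo-partial h n) (≈-refl {(1ˢ +ˢ -ˢ h) *ˢ h ^ˢ n}) ⟩
  (1ˢ +ˢ -ˢ (h ^ˢ n)) +ˢ (1ˢ +ˢ -ˢ h) *ˢ h ^ˢ n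
    ≈⟨ solve 2 (λ h p → (con 1ℤ :+ :- p) :+ (con 1ℤ :+ :- h) :* p := con 1ℤ :+ :- (p :* h)) ≈-refl h (h ^ˢ n) ⟩
  1ˢ +ˢ -ˢ (h ^ˢ suc n) ∎
  where open SetoidReasoning S.setoid

-- Coefficient m of `geo h` stops at the power h^m, and higher powers vanish there. Below q^M the
-- series is thus the M-term partial sum, which telescopes up to h^M.
geo-inverse : ∀ {h} → h ≈[ 1 ] 0ˢ → (1ˢ +ˢ -ˢ h) *ˢ geo h ≈ 1ˢ
geo-inverse {h} v = mod⇒≈ inv
  where
  inv : ∀ M → (1ˢ +ˢ -ˢ h) *ˢ geo h ≈[ M ] 1ˢ
  inv M = begin
    (1ˢ +ˢ -ˢ h) *ˢ geo h               ≈⟨ *ˢ-cong-mod (mod-refl {f = 1ˢ +ˢ -ˢ h}) truncate ⟩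
    (1ˢ +ˢ -ˢ h) *ˢ sumˢ M (h ^ˢ_)      ≈⟨ ≈⇒mod (geo-partial h M) ⟩
    1ˢ +ˢ -ˢ (h ^ˢ M)                   ≈⟨ +ˢ-cong-mod (mod-refl {f = 1ˢ}) (-ˢ-cong-mod (^ˢ-vanish M v)) ⟩
    1ˢ +ˢ -ˢ 0ˢ                         ≈⟨ ≈⇒mod (solve 0 (con 1ℤ :+ :- con 0ℤ := con 1ℤ) ≈-refl) ⟩
    1ˢ                                  ∎
    where
    open ModReasoning M
    truncate : geo h ≈[ M ] sumˢ M (h ^ˢ_)
    truncate = mod λ m m<M → sym (sumTo-extend (λ k → (h ^ˢ k) m) m<M
      λ k m<k _ → below (^ˢ-vanish k v) m m<k)

q : Series
q = mono 1

-- Partial sums for stack polyominoes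

infixl 6 _-ˢ_
_-ˢ_ : Series → Series → Series
f -ˢ g = f +ˢ -ˢ g

-- ∏_{n ≤ i < n + l} (1 - a qⁱ)
qprod : Series → ℕ → ℕ → Series
qprod a n zero    = 1ˢ
qprod a n (suc l) = (1ˢ -ˢ a *ˢ mono n) *ˢ qprod a (suc n) l

mono-suc : ∀ n → mono (suc n) ≈ mono n *ˢ q
mono-suc n = ≈-trans (mono-+ 1 n) (*ˢ-comm q (mono n))

qprod-shift : ∀ a n l → qprod (a *ˢ q) n l ≈ qprod a (suc n) l
qprod-shift a n zero    = ≈-refl
qprod-shift a n (suc l) = *ˢ-cong
  (+ˢ-cong (≈-refl {1ˢ}) (-ˢ-cong (≈-trans (S.*-assoc a q (mono n))
    (*ˢ-cong (≈-refl {a}) (≈-sym (mono-+ 1 n))))))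
  (qprod-shift a (suc n) l)

qprod-snoc : ∀ a n l → qprod a n (suc l) ≈ qprod a n l *ˢ (1ˢ -ˢ a *ˢ mono (n ℕ.+ l))
qprod-snoc a n zero    rewrite ℕ.+-identityʳ n = *ˢ-comm (1ˢ -ˢ a *ˢ mono n) 1ˢ
qprod-snoc a n (suc l) rewrite ℕ.+-suc n l = ≈-trans
  (*ˢ-cong (≈-refl {1ˢ -ˢ a *ˢ mono n}) (qprod-snoc a (suc n) l))
  (≈-sym (S.*-assoc (1ˢ -ˢ a *ˢ mono n) (qprod a (suc n) l) (1ˢ -ˢ a *ˢ mono (suc (n ℕ.+ l)))))

-- The quotient (aq;q)_{j+l} / (aq;q)_j = (aq^{j+1};q)_l, with abstract inverses `s` so that a = 1
-- covers (q;q) as well.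
qprod-cancel : ∀ {s : ℕ → Series} a → (∀ i → (1ˢ -ˢ a *ˢ mono (suc i)) *ˢ s (suc i) ≈ 1ˢ) →
               ∀ j l → qprod a 1 (j ℕ.+ l) *ˢ prod1 j s ≈ qprod a (suc j) l
qprod-cancel a inv zero    l = S.*-identityʳ (qprod a 1 l)
qprod-cancel {s} a inv (suc j) l = begin
  qprod a 1 (suc j ℕ.+ l) *ˢ (prod1 j s *ˢ s (suc j))
    ≡⟨ cong (λ k → qprod a 1 k *ˢ (prod1 j s *ˢ s (suc j))) (ℕ.+-suc j l) ⟨
  qprod a 1 (j ℕ.+ suc l) *ˢ (prod1 j s *ˢ s (suc j))
    ≈⟨ S.*-assoc (qprod a 1 (j ℕ.+ suc l)) (prod1 j s) (s (suc j)) ⟨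
  qprod a 1 (j ℕ.+ suc l) *ˢ prod1 j s *ˢ s (suc j)
    ≈⟨ *ˢ-cong (qprod-cancel a inv j (suc l)) (≈-refl {s (suc j)}) ⟩
  (1ˢ -ˢ a *ˢ mono (suc j)) *ˢ qprod a (suc (suc j)) l *ˢ s (suc j)
    ≈⟨ solve 3 (λ x y z → x :* y :* z := x :* z :* y) ≈-refl (1ˢ -ˢ a *ˢ mono (suc j)) (qprod a (suc (suc j)) l) (s (suc j)) ⟩
  (1ˢ -ˢ a *ˢ mono (suc j)) *ˢ s (suc j) *ˢ qprod a (suc (suc j)) l
    ≈⟨ *ˢ-cong (inv j) (≈-refl {qprod a (suc (suc j)) l}) ⟩
  1ˢ *ˢ qprod a (suc (suc j)) l
    ≈⟨ *ˢ-identityˡ (qprod a (suc (suc j)) l) ⟩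
  qprod a (suc (suc j)) l ∎
  where open SetoidReasoning S.setoid

-- Σ_{n ≤ m < n + l} q^m (q^{m+1};q)_{N-m} (a q^m;q)_{N+1-m} where N = n + l - 1
stackSum : ℕ → Series → ℕ → Series
stackSum n a zero    = 0ˢ
stackSum n a (suc l) = mono n *ˢ qprod 1ˢ (suc n) l *ˢ qprod a n (suc l) +ˢ stackSum (suc n) a l

-- Summation by parts, from q^m (q^{m+1};q)_{N-m} = (q^{m+1};q)_{N-m} - (q^m;q)_{N+1-m}.
stackSum-step : ∀ n a l → stackSum n a (suc l) ≈
  (1ˢ -ˢ qprod 1ˢ n (suc l) *ˢ qprod a n (suc l)) -ˢ
  a *ˢ ((1ˢ -ˢ mono (n ℕ.+ l)) *ˢ stackSum n (a *ˢ q) l +ˢ mono (n ℕ.+ l))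
stackSum-step n a zero rewrite ℕ.+-identityʳ n =
  solve 2 (λ x a → x :* con 1ℤ :* ((con 1ℤ :- a :* x) :* con 1ℤ) :+ con 0ℤ :=
    (con 1ℤ :- (con 1ℤ :- con 1ℤ :* x) :* con 1ℤ :* ((con 1ℤ :- a :* x) :* con 1ℤ)) :-
    a :* ((con 1ℤ :- x) :* con 0ℤ :+ x)) ≈-refl (mono n) a
-- In the sum at aq the (q;q) products end one factor earlier. `snoc` splits off this last factor 1
-- - w, and the lone w outside is the final summand, which has no counterpart there.
stackSum-step n a (suc l) rewrite ℕ.+-suc n l = begin
  x *ˢ qprod 1ˢ (suc n) (suc l) *ˢ ((1ˢ -ˢ a *ˢ x) *ˢ b) +ˢ stackSum (suc n) a (suc l)
    ≈⟨ +ˢ-cong (*ˢ-cong (*ˢ-cong (≈-refl {x}) snoc) (≈-refl {(1ˢ -ˢ a *ˢ x) *ˢ b}))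
               (≈-trans (stackSum-step (suc n) a l)
                 (+ˢ-cong (+ˢ-cong (≈-refl {1ˢ}) (-ˢ-cong (*ˢ-cong snoc (≈-refl {b}))))
                          (≈-refl { -ˢ (a *ˢ ((1ˢ -ˢ w) *ˢ t +ˢ w))}))) ⟩
  x *ˢ (α *ˢ (1ˢ -ˢ 1ˢ *ˢ w)) *ˢ ((1ˢ -ˢ a *ˢ x) *ˢ b) +ˢ
    ((1ˢ -ˢ α *ˢ (1ˢ -ˢ 1ˢ *ˢ w) *ˢ b) -ˢ a *ˢ ((1ˢ -ˢ w) *ˢ t +ˢ w))
    ≈⟨ solve 6 (λ x α w a b t →
         x :* (α :* (con 1ℤ :- con 1ℤ :* w)) :* ((con 1ℤ :- a :* x) :* b) :+
           ((con 1ℤ :- α :* (con 1ℤ :- con 1ℤ :* w) :* b) :- a :* ((con 1ℤ :- w) :* t :+ w)) :=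
         (con 1ℤ :- (con 1ℤ :- con 1ℤ :* x) :* (α :* (con 1ℤ :- con 1ℤ :* w)) :* ((con 1ℤ :- a :* x) :* b)) :-
           a :* ((con 1ℤ :- w) :* (x :* α :* b :+ t) :+ w)) ≈-refl x α w a b t ⟩
  (1ˢ -ˢ (1ˢ -ˢ 1ˢ *ˢ x) *ˢ (α *ˢ (1ˢ -ˢ 1ˢ *ˢ w)) *ˢ ((1ˢ -ˢ a *ˢ x) *ˢ b)) -ˢ
    a *ˢ ((1ˢ -ˢ w) *ˢ (x *ˢ α *ˢ b +ˢ t) +ˢ w)
    ≈⟨ +ˢ-cong
         (+ˢ-cong (≈-refl {1ˢ}) (-ˢ-cong (*ˢ-cong (*ˢ-cong (≈-refl {1ˢ -ˢ 1ˢ *ˢ x}) snoc) (≈-refl {(1ˢ -ˢ a *ˢ x) *ˢ b}))))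
         (-ˢ-cong (*ˢ-cong (≈-refl {a}) (+ˢ-cong (*ˢ-cong (≈-refl {1ˢ -ˢ w})
           (+ˢ-cong (*ˢ-cong (≈-refl {x *ˢ α}) (qprod-shift a n (suc l))) (≈-refl {t}))) (≈-refl {w})))) ⟨
  (1ˢ -ˢ qprod 1ˢ n (suc (suc l)) *ˢ qprod a n (suc (suc l))) -ˢ
    a *ˢ ((1ˢ -ˢ w) *ˢ stackSum n (a *ˢ q) (suc l) +ˢ w) ∎
  where
  open SetoidReasoning S.setoid
  x = mono n
  w = mono (suc (n ℕ.+ l))
  α = qprod 1ˢ (suc n) l
  b = qprod a (suc n) (suc l)
  t = stackSum (suc n) (a *ˢ q) l
  snoc : qprod 1ˢ (suc n) (suc l) ≈ α *ˢ (1ˢ -ˢ 1ˢ *ˢ w)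
  snoc = qprod-snoc 1ˢ (suc n) l

-- Partial sums for Ferrers diagrams

mono-square : ∀ n → mono (suc n ℕ.* suc n) ≈ mono (n ℕ.* n) *ˢ (mono n *ˢ mono (suc n))
mono-square n = subst (λ k → mono k ≈ mono (n ℕ.* n) *ˢ (mono n *ˢ mono (suc n))) (sym (lem n))
  (≈-trans (mono-+ (n ℕ.* n) (n ℕ.+ suc n)) (*ˢ-cong (≈-refl {mono (n ℕ.* n)}) (mono-+ n (suc n))))
  where
  lem : ∀ n → suc n ℕ.* suc n ≡ n ℕ.* n ℕ.+ (n ℕ.+ suc n)
  lem = solveℕ-∀

^ˢ-*q : ∀ a n → (a *ˢ q) ^ˢ n ≈ a ^ˢ n *ˢ mono n
^ˢ-*q a zero    = ≈-sym (S.*-identityʳ 1ˢ)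
^ˢ-*q a (suc n) = begin
  (a *ˢ q) ^ˢ n *ˢ (a *ˢ q)      ≈⟨ *ˢ-cong (^ˢ-*q a n) (≈-refl {a *ˢ q}) ⟩
  a ^ˢ n *ˢ mono n *ˢ (a *ˢ q)   ≈⟨ solve 4 (λ p x a q → p :* x :* (a :* q) := p :* a :* (x :* q)) ≈-refl (a ^ˢ n) (mono n) a q ⟩
  a ^ˢ n *ˢ a *ˢ (mono n *ˢ q)   ≈⟨ *ˢ-cong (≈-refl {a ^ˢ n *ˢ a}) (mono-suc n) ⟨
  a ^ˢ n *ˢ a *ˢ mono (suc n)    ∎
  where open SetoidReasoning S.setoid

-- The generating function of a square of side n, with its columns marked by a, above a partition
-- into parts at most n.
durfee : ℕ → Series → Series
durfee n a = (a ^ˢ n *ˢ mono (n ℕ.* n)) *ˢ invQPoch n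

durfee-shift : ∀ n a → durfee n (a *ˢ q) ≈ durfee n a *ˢ mono n
durfee-shift n a = ≈-trans
  (*ˢ-cong (*ˢ-cong (^ˢ-*q a n) (≈-refl {mono (n ℕ.* n)})) (≈-refl {invQPoch n}))
  (solve 4 (λ p x s u → p :* x :* s :* u := p :* s :* u :* x) ≈-refl
    (a ^ˢ n) (mono n) (mono (n ℕ.* n)) (invQPoch n))

mono-suc-vanish : ∀ i → mono (suc i) ≈[ 1 ] 0ˢ
mono-suc-vanish i = mod-weaken (s≤s z≤n) (mono-vanish (suc i))

-- From (n+1)² = n² + n + (n+1), while 1 - q^{n+1} cancels the newest factor of (q;q)_{n+1}. This
-- links consecutive summands in the telescoping of `durfeeSum-step`.
durfee-suc : ∀ n a → (1ˢ -ˢ mono (suc n)) *ˢ durfee (suc n) a ≈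
                     a *ˢ (mono n *ˢ mono (suc n)) *ˢ durfee n a
durfee-suc n a = begin
  (1ˢ -ˢ y) *ˢ (p *ˢ a *ˢ mono (suc n ℕ.* suc n) *ˢ (u *ˢ g))
    ≈⟨ *ˢ-cong (≈-refl {1ˢ -ˢ y}) (*ˢ-cong (*ˢ-cong (≈-refl {p *ˢ a}) (mono-square n)) (≈-refl {u *ˢ g})) ⟩
  (1ˢ -ˢ y) *ˢ (p *ˢ a *ˢ (s *ˢ xy) *ˢ (u *ˢ g))
    ≈⟨ solve 7 (λ y p a s xy u g → (con 1ℤ :- y) :* (p :* a :* (s :* xy) :* (u :* g)) :=
         (con 1ℤ :- y) :* g :* (a :* xy :* (p :* s :* u))) ≈-refl y p a s xy u g ⟩
  (1ˢ -ˢ y) *ˢ g *ˢ (a *ˢ xy *ˢ durfee n a)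
    ≈⟨ *ˢ-cong (geo-inverse (mono-suc-vanish n)) (≈-refl {a *ˢ xy *ˢ durfee n a}) ⟩
  1ˢ *ˢ (a *ˢ xy *ˢ durfee n a)
    ≈⟨ *ˢ-identityˡ (a *ˢ xy *ˢ durfee n a) ⟩
  a *ˢ xy *ˢ durfee n a ∎
  where
  open SetoidReasoning S.setoid
  y = mono (suc n)
  p = a ^ˢ n
  s = mono (n ℕ.* n)
  xy = mono n *ˢ y
  u = invQPoch n
  g = geo y

-- Σ_{n ≤ m < n + l} a^m q^{m²} (a q^m;q)_{N+1-m} / (q;q)_m where N = n + l - 1
ferrersSum : ℕ → Series → ℕ → Series
ferrersSum n a zero    = 0ˢ
ferrersSum n a (suc l) = durfee n a *ˢ qprod a n (suc l) +ˢ ferrersSum (suc n) a l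

-- Σ_{n ≤ m < n + l} a^m q^{m²} (a q^{m+1};q)_{N-m} / (q;q)_m where N = n + l - 1;
-- by Durfee squares its limit is 1 for n = 0.
durfeeSum : ℕ → Series → ℕ → Series
durfeeSum n a zero    = 0ˢ
durfeeSum n a (suc l) = durfee n a *ˢ qprod a (suc n) l +ˢ durfeeSum (suc n) a l

-- The first factor 1 - a q^m of each product is expanded. The part 1 gives `durfeeSum`; in the
-- other part q^m turns `durfee m a` into its value at aq. The last such summand is beyond the
-- shorter sum and remains as the error.
ferrersSum-step : ∀ n a l → ferrersSum n a (suc l) ≈
  (durfeeSum n a (suc l) -ˢ a *ˢ ferrersSum n (a *ˢ q) l) -ˢ
  a *ˢ mono (n ℕ.+ l) *ˢ durfee (n ℕ.+ l) a
ferrersSum-step n a zero rewrite ℕ.+-identityʳ n =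
  solve 3 (λ x a c → c :* ((con 1ℤ :- a :* x) :* con 1ℤ) :+ con 0ℤ :=
    ((c :* con 1ℤ :+ con 0ℤ) :- a :* con 0ℤ) :- a :* x :* c) ≈-refl (mono n) a (durfee n a)
ferrersSum-step n a (suc l) rewrite ℕ.+-suc n l = begin
  c *ˢ ((1ˢ -ˢ a *ˢ x) *ˢ b) +ˢ ferrersSum (suc n) a (suc l)
    ≈⟨ +ˢ-cong (≈-refl {c *ˢ ((1ˢ -ˢ a *ˢ x) *ˢ b)}) (ferrersSum-step (suc n) a l) ⟩
  c *ˢ ((1ˢ -ˢ a *ˢ x) *ˢ b) +ˢ ((d -ˢ a *ˢ f) -ˢ w)
    ≈⟨ solve 7 (λ a x b c d f w →
         c :* ((con 1ℤ :- a :* x) :* b) :+ ((d :- a :* f) :- w) :=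
         ((c :* b :+ d) :- a :* (c :* x :* b :+ f)) :- w) ≈-refl a x b c d f w ⟩
  ((c *ˢ b +ˢ d) -ˢ a *ˢ (c *ˢ x *ˢ b +ˢ f)) -ˢ w
    ≈⟨ +ˢ-cong (+ˢ-cong (≈-refl {c *ˢ b +ˢ d}) (-ˢ-cong (*ˢ-cong (≈-refl {a})
         (+ˢ-cong (*ˢ-cong (durfee-shift n a) (qprod-shift a n (suc l))) (≈-refl {f})))))
       (≈-refl { -ˢ w}) ⟨
  ((c *ˢ b +ˢ d) -ˢ a *ˢ ferrersSum n (a *ˢ q) (suc l)) -ˢ w ∎
  where
  open SetoidReasoning S.setoid
  x = mono n
  b = qprod a (suc n) (suc l)
  c = durfee n a
  d = durfeeSum (suc n) a (suc l)
  f = ferrersSum (suc n) (a *ˢ q) l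
  w = a *ˢ mono (suc (n ℕ.+ l)) *ˢ durfee (suc (n ℕ.+ l)) a

-- A finite form of D(a) = D(aq) for the Durfee sum D. The summands differ by a telescoping
-- quantity; its remainder carries the factor 1 - q^n and disappears at n = 0.
durfeeSum-step : ∀ n a l → durfeeSum n a (suc l) ≈
  (1ˢ -ˢ mono n) *ˢ durfee n a *ˢ qprod a (suc n) l +ˢ durfeeSum n (a *ˢ q) l +ˢ
  mono (n ℕ.+ l) *ˢ durfee (n ℕ.+ l) a
durfeeSum-step n a zero rewrite ℕ.+-identityʳ n =
  solve 2 (λ x c → c :* con 1ℤ :+ con 0ℤ :=
    (con 1ℤ :- x) :* c :* con 1ℤ :+ con 0ℤ :+ x :* c) ≈-refl (mono n) (durfee n a)
durfeeSum-step n a (suc l) rewrite ℕ.+-suc n l = begin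
  c *ˢ ((1ˢ -ˢ a *ˢ y) *ˢ β) +ˢ durfeeSum (suc n) a (suc l)
    ≈⟨ +ˢ-cong (≈-refl {c *ˢ ((1ˢ -ˢ a *ˢ y) *ˢ β)}) (≈-trans (durfeeSum-step (suc n) a l)
         (+ˢ-cong (+ˢ-cong (*ˢ-cong (durfee-suc n a) (≈-refl {β})) (≈-refl {d})) (≈-refl {w}))) ⟩
  c *ˢ ((1ˢ -ˢ a *ˢ y) *ˢ β) +ˢ (a *ˢ (x *ˢ y) *ˢ c *ˢ β +ˢ d +ˢ w)
    ≈⟨ solve 7 (λ a x y β c d w →
         c :* ((con 1ℤ :- a :* y) :* β) :+ (a :* (x :* y) :* c :* β :+ d :+ w) :=
         (con 1ℤ :- x) :* c :* ((con 1ℤ :- a :* y) :* β) :+ (c :* x :* β :+ d) :+ w)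
         ≈-refl a x y β c d w ⟩
  (1ˢ -ˢ x) *ˢ c *ˢ ((1ˢ -ˢ a *ˢ y) *ˢ β) +ˢ (c *ˢ x *ˢ β +ˢ d) +ˢ w
    ≈⟨ +ˢ-cong (+ˢ-cong (≈-refl {(1ˢ -ˢ x) *ˢ c *ˢ ((1ˢ -ˢ a *ˢ y) *ˢ β)})
         (+ˢ-cong (*ˢ-cong (durfee-shift n a) (qprod-shift a (suc n) l)) (≈-refl {d})))
       (≈-refl {w}) ⟨
  (1ˢ -ˢ x) *ˢ c *ˢ ((1ˢ -ˢ a *ˢ y) *ˢ β) +ˢ durfeeSum n (a *ˢ q) (suc l) +ˢ w ∎
  where
  open SetoidReasoning S.setoid
  x = mono n
  y = mono (suc n)
  β = qprod a (suc (suc n)) l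
  c = durfee n a
  d = durfeeSum (suc n) (a *ˢ q) l
  w = mono (suc (n ℕ.+ l)) *ˢ durfee (suc (n ℕ.+ l)) a

-- The functional equation of the partial theta function

-- The partial sums with N terms of a solution of F(a) = 1 - a F(aq), each correct to order N - 1
-- and better when a is divisible by q.
record IsTheta (F : ℕ → Series → Series) : Set where
  field
    start : ∀ a → F 0 a ≈ 0ˢ
    step  : ∀ N {k a} → a ≈[ k ] 0ˢ → F (suc N) a ≈[ N ℕ.+ k ] 1ˢ -ˢ a *ˢ F N (a *ˢ q)

*q-vanish : ∀ {k a} → a ≈[ k ] 0ˢ → a *ˢ q ≈[ suc k ] 0ˢ
*q-vanish {k} {a} v = subst (λ K → a *ˢ q ≈[ K ] 0ˢ) (ℕ.+-comm k 1) (*ˢ-vanish v (mono-vanish 1))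

-- Induction along (N, a) to (N - 1, aq), which preserves N + k. The predecessor reflects that
-- `step` for N + 1 terms is exact only to order N + k.
IsTheta-unique : ∀ {F G} → IsTheta F → IsTheta G →
                 ∀ N {k a} → a ≈[ k ] 0ˢ → F N a ≈[ ℕ.pred (N ℕ.+ k) ] G N a
IsTheta-unique {F} {G} F-θ G-θ = go
  where
  open IsTheta
  go : ∀ N {k a} → a ≈[ k ] 0ˢ → F N a ≈[ ℕ.pred (N ℕ.+ k) ] G N a
  go zero    {k} {a} v = ≈⇒mod (≈-trans (start F-θ a) (≈-sym (start G-θ a)))
  go (suc N) {k} {a} v = mod-trans (step F-θ N v) (mod-trans
    (+ˢ-cong-mod (mod-refl {f = 1ˢ}) (-ˢ-cong-mod (*ˢ-cong-mod (mod-refl {f = a}) ih)))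
    (mod-sym (step G-θ N v)))
    where
    ih : F N (a *ˢ q) ≈[ N ℕ.+ k ] G N (a *ˢ q)
    -- At aq the order is k + 1, so the predecessor of N + (k + 1) is the required N + k.
    ih = subst (λ K → F N (a *ˢ q) ≈[ ℕ.pred K ] G N (a *ˢ q)) (ℕ.+-suc N k) (go N (*q-vanish v))

thetaSum : ℕ → Series → Series
thetaSum N a = sumˢ N (λ n → (-ˢ a) ^ˢ n *ˢ mono (n C 2))

mono-C2 : ∀ n → mono (suc n C 2) ≈ mono n *ˢ mono (n C 2)
mono-C2 n = subst (λ k → mono k ≈ mono n *ˢ mono (n C 2))
  (trans (cong (ℕ._+ n C 2) (sym (nC1≡n n))) (nCk+nC[k+1]≡[n+1]C[k+1] n 1)) (mono-+ n (n C 2))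

thetaTerm-suc : ∀ a n → (-ˢ a) ^ˢ suc n *ˢ mono (suc n C 2) ≈
                        -ˢ a *ˢ ((-ˢ (a *ˢ q)) ^ˢ n *ˢ mono (n C 2))
thetaTerm-suc a n = begin
  p *ˢ -ˢ a *ˢ mono (suc n C 2)      ≈⟨ *ˢ-cong (≈-refl {p *ˢ -ˢ a}) (mono-C2 n) ⟩
  p *ˢ -ˢ a *ˢ (x *ˢ c)              ≈⟨ solve 4 (λ p a x c → p :* :- a :* (x :* c) := :- a :* (p :* x :* c)) ≈-refl p a x c ⟩
  -ˢ a *ˢ (p *ˢ x *ˢ c)              ≈⟨ *ˢ-cong (≈-refl { -ˢ a}) (*ˢ-cong (^ˢ-*q (-ˢ a) n) (≈-refl {c})) ⟨
  -ˢ a *ˢ ((-ˢ a *ˢ q) ^ˢ n *ˢ c)    ≈⟨ *ˢ-cong (≈-refl { -ˢ a}) (*ˢ-cong (^ˢ-cong n (solve 2 (λ a q → :- a :* q := :- (a :* q)) ≈-refl a q)) (≈-refl {c})) ⟩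
  -ˢ a *ˢ ((-ˢ (a *ˢ q)) ^ˢ n *ˢ c)  ∎
  where
  open SetoidReasoning S.setoid
  p = (-ˢ a) ^ˢ n
  x = mono n
  c = mono (n C 2)
  ^ˢ-cong : ∀ n {f g} → f ≈ g → f ^ˢ n ≈ g ^ˢ n
  ^ˢ-cong n e = mod⇒≈ λ M → ^ˢ-cong-mod n (≈⇒mod e)

sumˢ-front : ∀ N t → sumˢ (suc N) t ≈ t 0 +ˢ sumˢ N (t ∘ suc)
sumˢ-front N t = ptw λ m → sumTo-front N (λ i → t i m)

sumˢ-cong : ∀ N {t u} → (∀ i → t i ≈ u i) → sumˢ N t ≈ sumˢ N u
sumˢ-cong N e = ptw λ m → sumTo-cong N λ i _ → at (e i) m

thetaSum-isTheta : IsTheta thetaSum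
thetaSum-isTheta = record { start = λ _ → ≈-refl ; step = λ N {k} {a} _ → ≈⇒mod (step N a) }
  where
  open SetoidReasoning S.setoid
  step : ∀ N a → thetaSum (suc N) a ≈ 1ˢ -ˢ a *ˢ thetaSum N (a *ˢ q)
  step N a = begin
    thetaSum (suc N) a
      ≈⟨ sumˢ-front N (λ n → (-ˢ a) ^ˢ n *ˢ mono (n C 2)) ⟩
    1ˢ *ˢ 1ˢ +ˢ sumˢ N (λ n → (-ˢ a) ^ˢ suc n *ˢ mono (suc n C 2))
      ≈⟨ +ˢ-cong (S.*-identityʳ 1ˢ) (≈-trans (sumˢ-cong N (thetaTerm-suc a))
           (≈-sym (*ˢ-sumˢ N (-ˢ a) (λ n → (-ˢ (a *ˢ q)) ^ˢ n *ˢ mono (n C 2))))) ⟩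
    1ˢ +ˢ -ˢ a *ˢ thetaSum N (a *ˢ q)
      ≈⟨ solve 2 (λ a t → con 1ℤ :+ :- a :* t := con 1ℤ :- a :* t) ≈-refl a (thetaSum N (a *ˢ q)) ⟩
    1ˢ -ˢ a *ˢ thetaSum N (a *ˢ q) ∎

drop-error : ∀ {M f g e} → f ≈ g +ˢ e → e ≈[ M ] 0ˢ → f ≈[ M ] g
drop-error {g = g} p v = mod-trans (≈⇒mod p)
  (mod-trans (+ˢ-cong-mod (mod-refl {f = g}) v) (≈⇒mod (S.+-identityʳ g)))

vanish-comm : ∀ {K L f g} → f ≈[ K ] 0ˢ → g ≈[ L ] 0ˢ → f *ˢ g ≈[ L ℕ.+ K ] 0ˢ
vanish-comm {K} {L} {f} {g} p q = subst (λ M → f *ˢ g ≈[ M ] 0ˢ) (ℕ.+-comm K L) (*ˢ-vanish p q)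

-ˢ-vanish : ∀ {M f} → f ≈[ M ] 0ˢ → -ˢ f ≈[ M ] 0ˢ
-ˢ-vanish v = mod λ m m<M → cong -_ (below v m m<M)

stackSum-isTheta : IsTheta (λ N a → stackSum 0 a N)
stackSum-isTheta = record { start = λ _ → ≈-refl ; step = step }
  where
  step : ∀ N {k a} → a ≈[ k ] 0ˢ → stackSum 0 a (suc N) ≈[ N ℕ.+ k ] 1ˢ -ˢ a *ˢ stackSum 0 (a *ˢ q) N
  step N {k} {a} v = drop-error
    (≈-trans (stackSum-step 0 a N)
      -- At n = 0 the boundary product contains 1 - q^0 and vanishes. What is left of the error is a
      -- multiple of a q^N.
      (solve 5 (λ o b a w t →
        (con 1ℤ :- (con 1ℤ :- con 1ℤ :* con 1ℤ) :* o :* b) :- a :* ((con 1ℤ :- w) :* t :+ w) :=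
        con 1ℤ :- a :* t :+ a :* w :* (t :- con 1ℤ)) ≈-refl
        (qprod 1ˢ 1 N) (qprod a 0 (suc N)) a (mono N) (stackSum 0 (a *ˢ q) N)))
    (*ˢ-vanishˡ {g = stackSum 0 (a *ˢ q) N -ˢ 1ˢ} (vanish-comm v (mono-vanish N)))

durfee-vanish : ∀ n {k a} → a ≈[ k ] 0ˢ → durfee (suc n) a ≈[ k ] 0ˢ
durfee-vanish n {k} {a} v = *ˢ-vanishˡ {g = invQPoch (suc n)}
  (*ˢ-vanishˡ {g = mono (suc n ℕ.* suc n)} (*ˢ-vanishʳ {f = a ^ˢ n} v))

durfee-0 : ∀ a → durfee 0 a ≈ 1ˢ
durfee-0 a = solve 0 (con 1ℤ :* con 1ℤ :* con 1ℤ := con 1ℤ) ≈-refl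

-- Replacing a by aq repeatedly costs only q^N `durfee N a`, which is divisible by q^N a, and ends
-- at the single summand `durfee 0`, which is 1.
durfeeSum≈1 : ∀ N {k a} → a ≈[ k ] 0ˢ → durfeeSum 0 a (suc N) ≈[ N ℕ.+ k ] 1ˢ
durfeeSum≈1 zero {k} {a} v = ≈⇒mod (≈-trans
  (solve 1 (λ c → c :* con 1ℤ :+ con 0ℤ := c) ≈-refl (durfee 0 a)) (durfee-0 a))
durfeeSum≈1 (suc N) {k} {a} v = mod-trans
  (drop-error
    (≈-trans (durfeeSum-step 0 a (suc N))
      (solve 4 (λ c p d w → (con 1ℤ :- con 1ℤ) :* c :* p :+ d :+ w := d :+ w) ≈-refl
        (durfee 0 a) (qprod a 1 (suc N)) (durfeeSum 0 (a *ˢ q) (suc N))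
        (mono (suc N) *ˢ durfee (suc N) a)))
    (*ˢ-vanish (mono-vanish (suc N)) (durfee-vanish N v)))
  (subst (λ K → durfeeSum 0 (a *ˢ q) (suc N) ≈[ K ] 1ˢ) (ℕ.+-suc N k) (durfeeSum≈1 N (*q-vanish v)))

ferrersSum-isTheta : IsTheta (λ N a → ferrersSum 0 a N)
ferrersSum-isTheta = record { start = λ _ → ≈-refl ; step = step }
  where
  step : ∀ N {k a} → a ≈[ k ] 0ˢ → ferrersSum 0 a (suc N) ≈[ N ℕ.+ k ] 1ˢ -ˢ a *ˢ ferrersSum 0 (a *ˢ q) N
  step N {k} {a} v = mod-trans
    (drop-error (ferrersSum-step 0 a N)
      (-ˢ-vanish (*ˢ-vanishˡ {g = durfee N a} (vanish-comm v (mono-vanish N)))))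
    (+ˢ-cong-mod (durfeeSum≈1 N v) (mod-refl {f = -ˢ (a *ˢ ferrersSum 0 (a *ˢ q) N)}))

-- The root as a fixed point

-- `stackSum` and `ferrersSum` unfold at their first summand, `sumTo` at its last; this form
-- mediates between them.
sumFrom : (ℕ → Series) → ℕ → ℕ → Series
sumFrom t j zero    = 0ˢ
sumFrom t j (suc l) = t j +ˢ sumFrom t (suc j) l

sumˢ≈sumFrom : ∀ N t → sumˢ N t ≈ sumFrom t 0 N
sumˢ≈sumFrom N t = go N t (λ i → t i) 0 (λ i → ≈-refl)
  where
  go : ∀ N t u j → (∀ i → u i ≈ t (j ℕ.+ i)) → sumˢ N u ≈ sumFrom t j N
  go zero    t u j e = ≈-refl
  go (suc N) t u j e = ≈-trans (sumˢ-front N u) (+ˢ-cong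
    (subst (λ k → u 0 ≈ t k) (ℕ.+-identityʳ j) (e 0))
    (go N t (u ∘ suc) (suc j) λ i → subst (λ k → u (suc i) ≈ t k) (ℕ.+-suc j i) (e (suc i))))

invQPoch-inverse : ∀ i → (1ˢ -ˢ 1ˢ *ˢ mono (suc i)) *ˢ geo (mono (suc i)) ≈ 1ˢ
invQPoch-inverse i = ≈-trans
  (*ˢ-cong (+ˢ-cong (≈-refl {1ˢ}) (-ˢ-cong (*ˢ-identityˡ (mono (suc i))))) (≈-refl {geo (mono (suc i))}))
  (geo-inverse (mono-suc-vanish i))

invAQPoch-inverse : ∀ a i → (1ˢ -ˢ a *ˢ mono (suc i)) *ˢ geo (mono (suc i) *ˢ a) ≈ 1ˢ
invAQPoch-inverse a i = ≈-trans
  (*ˢ-cong (+ˢ-cong (≈-refl {1ˢ}) (-ˢ-cong (*ˢ-comm a (mono (suc i))))) (≈-refl {geo (mono (suc i) *ˢ a)}))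
  (geo-inverse (*ˢ-vanishˡ {g = a} (mono-suc-vanish i)))

cancelQ : ∀ j l → qprod 1ˢ 1 (j ℕ.+ l) *ˢ invQPoch j ≈ qprod 1ˢ (suc j) l
cancelQ = qprod-cancel {λ i → geo (mono i)} 1ˢ invQPoch-inverse

cancelAQ : ∀ a j l → qprod a 1 (j ℕ.+ l) *ˢ invAQPoch a j ≈ qprod a (suc j) l
cancelAQ a = qprod-cancel {λ i → geo (mono i *ˢ a)} a (invAQPoch-inverse a)

partialSum : Bool → ℕ → Series → Series
partialSum false N a = stackSum 0 a N
partialSum true  N a = ferrersSum 0 a N

partialSum-isTheta : ∀ b → IsTheta (partialSum b)
partialSum-isTheta false = stackSum-isTheta
partialSum-isTheta true  = ferrersSum-isTheta

-- Truncations of the infinite products relating Θ(a) to F(a) - a, long enough to clear the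
-- denominators of the first N summands of F.
denominator : Bool → ℕ → Series → Series
denominator false N a = qprod 1ˢ 1 N *ˢ qprod a 1 N
denominator true  N a = qprod a 1 N

denominator⁻¹ : Bool → ℕ → Series → Series
denominator⁻¹ false N a = invQPoch N *ˢ invAQPoch a N
denominator⁻¹ true  N a = invAQPoch a N

denominator-inverse : ∀ b N a → denominator⁻¹ b N a *ˢ denominator b N a ≈ 1ˢ
denominator-inverse b N a = go b
  where
  open SetoidReasoning S.setoid
  Q : qprod 1ˢ 1 N *ˢ invQPoch N ≈ 1ˢ
  Q = subst (λ k → qprod 1ˢ 1 k *ˢ invQPoch N ≈ 1ˢ) (ℕ.+-identityʳ N) (cancelQ N 0)
  AQ : qprod a 1 N *ˢ invAQPoch a N ≈ 1ˢ
  AQ = subst (λ k → qprod a 1 k *ˢ invAQPoch a N ≈ 1ˢ) (ℕ.+-identityʳ N) (cancelAQ a N 0)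
  go : ∀ b → denominator⁻¹ b N a *ˢ denominator b N a ≈ 1ˢ
  go true  = ≈-trans (*ˢ-comm (invAQPoch a N) (qprod a 1 N)) AQ
  go false = begin
    invQPoch N *ˢ invAQPoch a N *ˢ (qprod 1ˢ 1 N *ˢ qprod a 1 N)
      ≈⟨ solve 4 (λ u v x y → u :* v :* (x :* y) := (x :* u) :* (y :* v)) ≈-refl
           (invQPoch N) (invAQPoch a N) (qprod 1ˢ 1 N) (qprod a 1 N) ⟩
    (qprod 1ˢ 1 N *ˢ invQPoch N) *ˢ (qprod a 1 N *ˢ invAQPoch a N)
      ≈⟨ *ˢ-cong Q AQ ⟩
    1ˢ *ˢ 1ˢ
      ≈⟨ *ˢ-identityˡ 1ˢ ⟩
    1ˢ ∎

-- Each summand has the denominator (q;q)_{j+1} (aq;q)_j, and the common product of N factors leaves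
-- exactly the tails occurring in `stackSum`. The separate N stays fixed while j grows.
stackSum-factor : ∀ a l j N → j ℕ.+ l ≡ N →
  stackSum (suc j) a l ≈ denominator false N a *ˢ sumFrom (termF false a ∘ suc) j l
stackSum-factor a zero    j N e = ≈-sym (S.zeroʳ (denominator false N a))
stackSum-factor a (suc l) j N e = begin
  x *ˢ qprod 1ˢ (suc (suc j)) l *ˢ qprod a (suc j) (suc l) +ˢ stackSum (suc (suc j)) a l
    ≈⟨ +ˢ-cong (*ˢ-cong (*ˢ-cong (≈-refl {x})
           (subst (λ k → qprod 1ˢ 1 k *ˢ u ≈ qprod 1ˢ (suc (suc j)) l) e′ (cancelQ (suc j) l)))
           (subst (λ k → qprod a 1 k *ˢ v ≈ qprod a (suc j) (suc l)) e (cancelAQ a j (suc l))))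
         (≈-sym (stackSum-factor a l (suc j) N e′)) ⟨
  x *ˢ (A *ˢ u) *ˢ (B *ˢ v) +ˢ A *ˢ B *ˢ r
    ≈⟨ solve 6 (λ x A B u v r → x :* (A :* u) :* (B :* v) :+ A :* B :* r :=
         A :* B :* (x :* u :* v :+ r)) ≈-refl x A B u v r ⟩
  A *ˢ B *ˢ (x *ˢ u *ˢ v +ˢ r) ∎
  where
  open SetoidReasoning S.setoid
  e′ = trans (sym (ℕ.+-suc j l)) e
  x = mono (suc j)
  A = qprod 1ˢ 1 N
  B = qprod a 1 N
  u = invQPoch (suc j)
  v = invAQPoch a j
  r = sumFrom (termF false a ∘ suc) (suc j) l

ferrersSum-factor : ∀ a l j N → j ℕ.+ l ≡ N →
  ferrersSum (suc j) a l ≈ denominator true N a *ˢ sumFrom (termF true a ∘ suc) j l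
ferrersSum-factor a zero    j N e = ≈-sym (S.zeroʳ (denominator true N a))
ferrersSum-factor a (suc l) j N e = begin
  c *ˢ qprod a (suc j) (suc l) +ˢ ferrersSum (suc (suc j)) a l
    ≈⟨ +ˢ-cong (*ˢ-cong (≈-refl {c})
           (subst (λ k → qprod a 1 k *ˢ v ≈ qprod a (suc j) (suc l)) e (cancelAQ a j (suc l))))
         (≈-sym (ferrersSum-factor a l (suc j) N e′)) ⟨
  c *ˢ (B *ˢ v) +ˢ B *ˢ r
    ≈⟨ solve 4 (λ c B v r → c :* (B :* v) :+ B :* r := B :* (c :* v :+ r)) ≈-refl c B v r ⟩
  B *ˢ (c *ˢ v +ˢ r) ∎
  where
  open SetoidReasoning S.setoid
  e′ = trans (sym (ℕ.+-suc j l)) e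
  c = durfee (suc j) a
  B = qprod a 1 N
  v = invAQPoch a j
  r = sumFrom (termF true a ∘ suc) (suc j) l

-- The summand m = 0 is the only one with the factor 1 - a q^0, which survives when (aq;q)_N is
-- taken out. It is the origin of the -a in F(a) - a.
partialSum-factor : ∀ b N a → partialSum b (suc N) a ≈
  denominator b N a *ˢ ((1ˢ -ˢ a) +ˢ sumˢ N (termF b a ∘ suc))
partialSum-factor false N a = begin
  1ˢ *ˢ A *ˢ ((1ˢ -ˢ a *ˢ 1ˢ) *ˢ B) +ˢ stackSum 1 a N
    ≈⟨ +ˢ-cong (≈-refl {1ˢ *ˢ A *ˢ ((1ˢ -ˢ a *ˢ 1ˢ) *ˢ B)}) (≈-trans (stackSum-factor a N 0 N refl)
         (*ˢ-cong (≈-refl {A *ˢ B}) (≈-sym (sumˢ≈sumFrom N (termF false a ∘ suc))))) ⟩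
  1ˢ *ˢ A *ˢ ((1ˢ -ˢ a *ˢ 1ˢ) *ˢ B) +ˢ A *ˢ B *ˢ s
    ≈⟨ solve 4 (λ a A B s → con 1ℤ :* A :* ((con 1ℤ :- a :* con 1ℤ) :* B) :+ A :* B :* s :=
         A :* B :* ((con 1ℤ :- a) :+ s)) ≈-refl a A B s ⟩
  A *ˢ B *ˢ ((1ˢ -ˢ a) +ˢ s) ∎
  where
  open SetoidReasoning S.setoid
  A = qprod 1ˢ 1 N
  B = qprod a 1 N
  s = sumˢ N (termF false a ∘ suc)
partialSum-factor true N a = begin
  durfee 0 a *ˢ ((1ˢ -ˢ a *ˢ 1ˢ) *ˢ B) +ˢ ferrersSum 1 a N
    ≈⟨ +ˢ-cong (*ˢ-cong (durfee-0 a) (≈-refl {(1ˢ -ˢ a *ˢ 1ˢ) *ˢ B})) (≈-trans (ferrersSum-factor a N 0 N refl)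
         (*ˢ-cong (≈-refl {B}) (≈-sym (sumˢ≈sumFrom N (termF true a ∘ suc))))) ⟩
  1ˢ *ˢ ((1ˢ -ˢ a *ˢ 1ˢ) *ˢ B) +ˢ B *ˢ s
    ≈⟨ solve 3 (λ a B s → con 1ℤ :* ((con 1ℤ :- a :* con 1ℤ) :* B) :+ B :* s :=
         B :* ((con 1ℤ :- a) :+ s)) ≈-refl a B s ⟩
  B *ˢ ((1ˢ -ˢ a) +ˢ s) ∎
  where
  open SetoidReasoning S.setoid
  B = qprod a 1 N
  s = sumˢ N (termF true a ∘ suc)

termF-vanish : ∀ b a n → termF b a (suc n) ≈[ suc n ] 0ˢ
termF-vanish false a n = *ˢ-vanishˡ {g = invAQPoch a n}
  (*ˢ-vanishˡ {g = invQPoch (suc n)} (mono-vanish (suc n)))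
termF-vanish true  a n = *ˢ-vanishˡ {g = invAQPoch a n} (*ˢ-vanishˡ {g = invQPoch (suc n)}
  (*ˢ-vanishʳ {f = a ^ˢ suc n} (mod-weaken (ℕ.m≤m*n (suc n) (suc n)) (mono-vanish (suc n ℕ.* suc n)))))

Fq-coeff : ∀ b a m → Fq b a m ≡ 1ˢ m ℤ.+ sumTo (suc m) (λ i → termF b a (suc i) m)
Fq-coeff b a m = cong₂ ℤ._+_ {x = 1ˢ m} refl (trans (sumTo-front (suc m) _) (ℤ.+-identityˡ _))

Fq-truncate : ∀ b a N → Fq b a ≈[ N ] 1ˢ +ˢ sumˢ N (termF b a ∘ suc)
Fq-truncate b a N = mod λ m m<N → trans (Fq-coeff b a m)
  (cong₂ ℤ._+_ {x = 1ˢ m} refl (sym (sumTo-extend (λ i → termF b a (suc i) m) m<N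
    λ i m<i _ → below (termF-vanish b a i) m (ℕ.m<n⇒m<1+n m<i))))

thetaTerm-vanish : ∀ a n → (-ˢ a) ^ˢ suc n *ˢ mono (suc n C 2) ≈[ n ] 0ˢ
thetaTerm-vanish a n = *ˢ-vanishʳ {f = (-ˢ a) ^ˢ suc n}
  (mod-trans (≈⇒mod (mono-C2 n)) (*ˢ-vanishˡ {g = mono (n C 2)} (mono-vanish n)))

-- One term more than the order is needed: a may have a constant term, and then term n + 1 is only
-- guaranteed to be divisible by q^n.
thetaNeg-truncate : ∀ a N → thetaNeg a ≈[ N ] thetaSum (suc N) a
thetaNeg-truncate a N = mod λ m m<N → sym (sumTo-extend
  (λ n → ((-ˢ a) ^ˢ n *ˢ mono (n C 2)) m) (s≤s m<N)
  λ { (suc i) 1+m<i _ → below (thetaTerm-vanish a i) m (ℕ.≤-pred 1+m<i) })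

-- Uniqueness is applied with N + 1 terms and k = 0, since nothing is assumed about a; this gives
-- order N.
thetaNeg-factor : ∀ b a N → thetaNeg a ≈[ N ] denominator b N a *ˢ (Fq b a -ˢ a)
thetaNeg-factor b a N = begin
  thetaNeg a
    ≈⟨ thetaNeg-truncate a N ⟩
  thetaSum (suc N) a
    ≈⟨ subst (λ K → thetaSum (suc N) a ≈[ K ] partialSum b (suc N) a) (ℕ.+-identityʳ N)
         (IsTheta-unique thetaSum-isTheta (partialSum-isTheta b) (suc N) vanish-0) ⟩
  partialSum b (suc N) a
    ≈⟨ ≈⇒mod (partialSum-factor b N a) ⟩
  denominator b N a *ˢ ((1ˢ -ˢ a) +ˢ sumˢ N (termF b a ∘ suc))
    ≈⟨ *ˢ-cong-mod (mod-refl {f = denominator b N a}) (mod-trans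
         (≈⇒mod (solve 2 (λ a s → (con 1ℤ :- a) :+ s := (con 1ℤ :+ s) :- a) ≈-refl a (sumˢ N (termF b a ∘ suc))))
         (+ˢ-cong-mod (mod-sym (Fq-truncate b a N)) (mod-refl {f = -ˢ a}))) ⟩
  denominator b N a *ˢ (Fq b a -ˢ a) ∎
  where open ModReasoning N

fixedPoint⇒root : ∀ b {a} → Fq b a ≈ a → IsXi0 a
fixedPoint⇒root b {a} p m = below (mod-trans (thetaNeg-factor b a (suc m)) (*ˢ-vanishʳ {f = denominator b (suc m) a}
  (≈⇒mod (≈-trans (+ˢ-cong p (≈-refl { -ˢ a})) (S.-‿inverseʳ a))))) m ℕ.≤-refl

root⇒fixedPoint : ∀ b {a} → IsXi0 a → Fq b a ≈ a
root⇒fixedPoint b {a} p = mod⇒≈ λ N →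
  let open ModReasoning N
      D = denominator b N a
      D⁻¹ = denominator⁻¹ b N a
      f = Fq b a
  in begin
    f                              ≈⟨ ≈⇒mod (solve 2 (λ f a → f := con 1ℤ :* (f :- a) :+ a) ≈-refl f a) ⟩
    1ˢ *ˢ (f -ˢ a) +ˢ a            ≈⟨ ≈⇒mod (+ˢ-cong (*ˢ-cong (denominator-inverse b N a) (≈-refl {f -ˢ a})) (≈-refl {a})) ⟨
    D⁻¹ *ˢ D *ˢ (f -ˢ a) +ˢ a      ≈⟨ ≈⇒mod (+ˢ-cong (S.*-assoc D⁻¹ D (f -ˢ a)) (≈-refl {a})) ⟩
    D⁻¹ *ˢ (D *ˢ (f -ˢ a)) +ˢ a    ≈⟨ +ˢ-cong-mod (*ˢ-vanishʳ {f = D⁻¹} (mod-trans (mod-sym (thetaNeg-factor b a N)) (mod λ m _ → p m))) (mod-refl {f = a}) ⟩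
    0ˢ +ˢ a                        ≈⟨ ≈⇒mod (S.+-identityˡ a) ⟩
    a                              ∎

-- Iteration of F⁽⁰⁾ and F⁽¹⁾

geo-cong-mod : ∀ {M g h} → g ≈[ M ] h → geo g ≈[ M ] geo h
geo-cong-mod p = mod λ m m<M → sumTo-cong (suc m) λ k _ → below (^ˢ-cong-mod k p) m m<M

prod1-cong-mod : ∀ {M s t} n → (∀ i → s (suc i) ≈[ M ] t (suc i)) → prod1 n s ≈[ M ] prod1 n t
prod1-cong-mod zero    e = mod-refl
prod1-cong-mod (suc n) e = *ˢ-cong-mod (prod1-cong-mod n e) (e n)

-- Every occurrence of a comes with a positive power of q: q^{i+1} a in the denominator, q^{(n+1)²}
-- in the numerator.
termF-contract : ∀ b {M a a′} n → a ≈[ M ] a′ → termF b a (suc n) ≈[ suc M ] termF b a′ (suc n)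
termF-contract b {M} {a} {a′} n p = go b
  where
  denom : invAQPoch a n ≈[ suc M ] invAQPoch a′ n
  denom = prod1-cong-mod {s = λ i → geo (mono i *ˢ a)} {λ i → geo (mono i *ˢ a′)} n
    λ i → geo-cong-mod (*ˢ-cong-modʳ (mono-suc-vanish i) p)
  go : ∀ b → termF b a (suc n) ≈[ suc M ] termF b a′ (suc n)
  go false = *ˢ-cong-mod (mod-refl {f = mono (suc n) *ˢ invQPoch (suc n)}) denom
  go true  = *ˢ-cong-mod (*ˢ-cong-mod numer (mod-refl {f = invQPoch (suc n)})) denom
    where
    k = suc n ℕ.* suc n
    numer : a ^ˢ suc n *ˢ mono k ≈[ suc M ] a′ ^ˢ suc n *ˢ mono k
    numer = mod-trans (≈⇒mod (*ˢ-comm (a ^ˢ suc n) (mono k))) (mod-trans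
      (*ˢ-cong-modʳ (mono-suc-vanish (n ℕ.+ n ℕ.* suc n)) (^ˢ-cong-mod (suc n) p))
      (≈⇒mod (*ˢ-comm (mono k) (a′ ^ˢ suc n))))

Fq-contract : ∀ b {M a a′} → a ≈[ M ] a′ → Fq b a ≈[ suc M ] Fq b a′
Fq-contract b {M} {a} {a′} p = mod λ m m≤M → trans (Fq-coeff b a m) (trans
  (cong₂ ℤ._+_ {x = 1ˢ m} refl (sumTo-cong (suc m) λ i _ → below (termF-contract b i p) m m≤M))
  (sym (Fq-coeff b a′ m)))

Fq-cong : ∀ b {a a′} → a ≈ a′ → Fq b a ≈ Fq b a′
Fq-cong b p = mod⇒≈ λ M → mod-weaken (ℕ.n≤1+n M) (Fq-contract b (≈⇒mod p))

compose-contract : ∀ σ N a a′ → compose σ N a ≈[ suc N ] compose σ N a′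
compose-contract σ zero    a a′ = Fq-contract (σ 0) (mod λ _ ())
compose-contract σ (suc N) a a′ = Fq-contract (σ 0) (compose-contract (σ ∘ suc) N a a′)

compose-fixed : ∀ {ξ} → (∀ b → Fq b ξ ≈ ξ) → ∀ σ N → compose σ N ξ ≈ ξ
compose-fixed fix σ zero    = fix (σ 0)
compose-fixed fix σ (suc N) = ≈-trans (Fq-cong (σ 0) (compose-fixed fix (σ ∘ suc) N)) (fix (σ 0))

root≡xiSigma : ∀ {ξ} → IsXi0 ξ → ∀ σ A → ξ A ≡ xiSigma σ A A
root≡xiSigma {ξ} root σ A = trans
  (sym (at (compose-fixed (λ b → root⇒fixedPoint b root) σ A) A))
  (below (compose-contract σ A ξ 0ˢ) A ℕ.≤-refl)

iterate : ℕ → Series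
iterate = xiSigma (λ _ → false)

-- The equinumerosity claim supplies no root, so one is built as the diagonal of the iterates, whose
-- coefficient A is stable from the A-th iterate on.
xi0 : Series
xi0 A = iterate A A

xi0-iterate : ∀ N → xi0 ≈[ suc N ] iterate N
xi0-iterate N = mod λ m m≤N → go m N (ℕ.≤-pred m≤N)
  where
  iterate-suc : ∀ N → iterate N ≈[ suc N ] iterate (suc N)
  iterate-suc zero    = Fq-contract false (mod λ _ ())
  iterate-suc (suc N) = Fq-contract false (iterate-suc N)
  go : ∀ m N → m ≤ N → iterate m m ≡ iterate N m
  go m N m≤N with ℕ.m≤n⇒m<n∨m≡n m≤N
  ... | inj₂ refl = refl
  go m (suc N) _ | inj₁ m<1+N = trans (go m N (ℕ.≤-pred m<1+N)) (below (iterate-suc N) m m<1+N)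

xi0-root : IsXi0 xi0
-- Modulo q^{M+2}, F maps `xi0` to F of the M-th iterate, which is the next iterate and agrees with
-- `xi0` to the same order.
xi0-root = fixedPoint⇒root false (mod⇒≈ λ M → mod-weaken (ℕ.≤-trans (ℕ.n≤1+n M) (ℕ.n≤1+n (suc M)))
  (mod-trans (Fq-contract false (xi0-iterate M)) (mod-sym (xi0-iterate (suc M)))))

-- Counting by weight

Count : ℤ → Set → Set
Count z X = Σ ℕ λ k → (z ≡ + k) × (Fin k ↔ X)

Fiber : {X : Set} → (X → ℕ) → ℕ → Set
Fiber {X} w A = Σ X λ x → w x ≡ A

record Counted {X : Set} (w : X → ℕ) (f : Series) : Set where
  constructor counted
  field count : ∀ A → Count (f A) (Fiber w A)
open Counted

Count-↔ : ∀ {z X Y} → X ↔ Y → Count z X → Count z Y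
Count-↔ i (k , e , j) = k , e , ↔-trans j i

Count-≡ : ∀ {z z′ X} → z ≡ z′ → Count z X → Count z′ X
Count-≡ refl c = c

Count-empty : ∀ {X} → ¬ X → Count 0ℤ X
Count-empty ¬x = 0 , refl , mk↔ₛ′ (λ ()) (⊥-elim ∘ ¬x) (⊥-elim ∘ ¬x) (λ ())

Count-⊎ : ∀ {y z X Y} → Count y X → Count z Y → Count (y ℤ.+ z) (X ⊎ Y)
Count-⊎ (j , refl , f) (k , refl , g) =
  j ℕ.+ k , sym (ℤ.pos-+ j k) , ↔-trans Fin.+↔⊎ (f ⊎-↔ g)

Count-× : ∀ {y z X Y} → Count y X → Count z Y → Count (y ℤ.* z) (X × Y)
Count-× (j , refl , f) (k , refl , g) =
  j ℕ.* k , sym (ℤ.pos-* j k) , ↔-trans Fin.*↔× (f ×-↔ g)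

Count-sumTo : ∀ n (X : ℕ → Set) {f} → (∀ i → i < n → Count (f i) (X i)) →
              Count (sumTo n f) (Σ ℕ λ i → i < n × X i)
Count-sumTo zero    X c = Count-empty λ ()
Count-sumTo (suc n) X c =
  Count-↔ split (Count-⊎ (Count-sumTo n X λ i i<n → c i (ℕ.m<n⇒m<1+n i<n)) (c n ℕ.≤-refl))
  where
  to : (Σ ℕ λ i → i < n × X i) ⊎ X n → Σ ℕ λ i → i < suc n × X i
  to (inj₁ (i , i<n , x)) = i , ℕ.m<n⇒m<1+n i<n , x
  to (inj₂ x)             = n , ℕ.≤-refl , x
  place : ∀ {i} → X i → i < n ⊎ i ≡ n → (Σ ℕ λ i → i < n × X i) ⊎ X n
  place x (inj₁ i<n) = inj₁ (_ , i<n , x)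
  place x (inj₂ i≡n) = inj₂ (subst X i≡n x)
  from : (Σ ℕ λ i → i < suc n × X i) → (Σ ℕ λ i → i < n × X i) ⊎ X n
  from (i , i<1+n , x) = place x (ℕ.m<1+n⇒m<n∨m≡n i<1+n)
  to∘from : ∀ y → to (from y) ≡ y
  to∘from (i , i<1+n , x) with ℕ.m<1+n⇒m<n∨m≡n i<1+n
  ... | inj₁ i<n  = cong (λ p → i , p , x) (ℕ.<-irrelevant _ _)
  ... | inj₂ refl = cong (λ p → n , p , x) (ℕ.<-irrelevant _ _)
  from∘to : ∀ y → from (to y) ≡ y
  from∘to (inj₁ (i , i<n , x)) with ℕ.m<1+n⇒m<n∨m≡n (ℕ.m<n⇒m<1+n i<n)
  ... | inj₁ _    = cong (λ p → inj₁ (i , p , x)) (ℕ.<-irrelevant _ _)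
  ... | inj₂ refl = ⊥-elim (ℕ.<-irrefl refl i<n)
  from∘to (inj₂ x) with ℕ.m<1+n⇒m<n∨m≡n (ℕ.≤-refl {suc n})
  ... | inj₁ n<n  = ⊥-elim (ℕ.<-irrefl refl n<n)
  ... | inj₂ e    = cong (λ e → inj₂ (subst X e x)) (ℕ.≡-irrelevant e refl)
  split = mk↔ₛ′ to from to∘from from∘to

Fiber-≡ : ∀ {X : Set} {w : X → ℕ} {A} {x y : Fiber w A} → proj₁ x ≡ proj₁ y → x ≡ y
Fiber-≡ {x = x , p} {_ , q} refl = cong (x ,_) (ℕ.≡-irrelevant p q)

infix 4 _≅_
record _≅_ {X Y : Set} (v : X → ℕ) (w : Y → ℕ) : Set where
  constructor weighted
  field
    bijection : X ↔ Y
    weight    : ∀ x → w (Inverse.to bijection x) ≡ v x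
open _≅_

module _ {X Y : Set} {v : X → ℕ} {w : Y → ℕ} where

  ≅-sym : v ≅ w → w ≅ v
  ≅-sym i = weighted (↔-sym (bijection i)) λ y →
    trans (sym (weight i (Inverse.from (bijection i) y))) (cong w (Inverse.strictlyInverseˡ (bijection i) y))

  Fiber-↔ : v ≅ w → ∀ {A} → Fiber v A ↔ Fiber w A
  Fiber-↔ i = mk↔ₛ′
    (λ (x , p) → to x , trans (weight i x) p)
    (λ (y , p) → from y , trans (weight (≅-sym i) y) p)
    (λ (y , _) → Fiber-≡ (strictlyInverseˡ y))
    (λ (x , _) → Fiber-≡ (strictlyInverseʳ x))
    where open Inverse (bijection i)

  Counted-≅ : ∀ {f} → v ≅ w → Counted v f → Counted w f
  Counted-≅ i c = counted λ A → Count-↔ (Fiber-↔ i) (count c A)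

infixr 5 _+ʷ_
_+ʷ_ : {X Y : Set} → (X → ℕ) → (Y → ℕ) → X × Y → ℕ
(v +ʷ w) (x , y) = v x ℕ.+ w y

module _ {X Y : Set} {v : X → ℕ} {w : Y → ℕ} {A : ℕ} where

  Fiber-⊎ : (Fiber v A ⊎ Fiber w A) ↔ Fiber [ v , w ]′ A
  Fiber-⊎ = mk↔ₛ′
    (λ { (inj₁ (x , p)) → inj₁ x , p ; (inj₂ (y , p)) → inj₂ y , p })
    (λ { (inj₁ x , p) → inj₁ (x , p) ; (inj₂ y , p) → inj₂ (y , p) })
    (λ { (inj₁ x , p) → refl ; (inj₂ y , p) → refl })
    (λ { (inj₁ (x , p)) → refl ; (inj₂ (y , p)) → refl })

  Fiber-× : (Σ ℕ λ k → k < suc A × (Fiber v k × Fiber w (A ∸ k))) ↔ Fiber (v +ʷ w) A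
  Fiber-× = mk↔ₛ′ to from (λ _ → Fiber-≡ refl) from∘to
    where
    to : (Σ ℕ λ k → k < suc A × (Fiber v k × Fiber w (A ∸ k))) → Fiber (v +ʷ w) A
    to (_ , k≤A , (x , refl) , (y , p)) = (x , y) ,
      trans (cong (v x ℕ.+_) p) (ℕ.m+[n∸m]≡n (ℕ.≤-pred k≤A))
    from : Fiber (v +ʷ w) A → Σ ℕ λ k → k < suc A × (Fiber v k × Fiber w (A ∸ k))
    from ((x , y) , p) = v x , s≤s (subst (v x ≤_) p (ℕ.m≤m+n (v x) (w y))) , (x , refl) ,
      (y , trans (sym (ℕ.m+n∸m≡n (v x) (w y))) (cong (_∸ v x) p))
    from∘to : ∀ z → from (to z) ≡ z
    from∘to (_ , k≤A , (x , refl) , (y , p)) =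
      cong₂ (λ k≤A p → v x , k≤A , (x , refl) , (y , p)) (ℕ.<-irrelevant _ _) (ℕ.≡-irrelevant _ _)

module _ {X Y : Set} {v : X → ℕ} {w : Y → ℕ} {f g : Series} where

  Counted-⊎ : Counted v f → Counted w g → Counted [ v , w ]′ (f +ˢ g)
  Counted-⊎ c d = counted λ A → Count-↔ Fiber-⊎ (Count-⊎ (count c A) (count d A))

  Counted-× : Counted v f → Counted w g → Counted (v +ʷ w) (f *ˢ g)
  Counted-× c d = counted λ A → Count-↔ Fiber-×
    (Count-sumTo (suc A) (λ k → Fiber v k × Fiber w (A ∸ k)) λ k _ → Count-× (count c k) (count d (A ∸ k)))

Counted-≈ : ∀ {X : Set} {w : X → ℕ} {f g} → f ≈ g → Counted w f → Counted w g
Counted-≈ p c = counted λ A → Count-≡ (at p A) (count c A)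

Counted-empty : ∀ {X : Set} {w : X → ℕ} → ¬ X → Counted w 0ˢ
Counted-empty ¬x = counted λ A → Count-empty (¬x ∘ proj₁)

Counted-mono : ∀ k → Counted {⊤} (λ _ → k) (mono k)
Counted-mono k = counted λ A → go k A
  where
  go : ∀ k A → Count (mono k A) (⊤ × k ≡ A)
  go k A with k ≡ᵇ A in eq
  ... | true  = 1 , refl , ↔-trans Fin.1↔⊤ (mk↔ₛ′ (λ _ → tt , ℕ.≡ᵇ⇒≡ k A (subst T (sym eq) tt))
                  (λ _ → tt) (λ _ → Fiber-≡ refl) (λ _ → refl))
  ... | false = Count-empty λ (_ , p) → subst T eq (ℕ.≡⇒≡ᵇ k A p)

Σʷ : {X : ℕ → Set} → (∀ n → X n → ℕ) → Σ ℕ X → ℕ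
Σʷ w (n , x) = w n x

-- As the index never exceeds the weight, objects of weight A have index at most A and the finite
-- sum misses none.
Counted-Σ : ∀ {X : ℕ → Set} {w : ∀ n → X n → ℕ} {t : ℕ → Series} → (∀ n x → n ≤ w n x) →
            (∀ n → Counted (w n) (t n)) → Counted (Σʷ {X} w) (λ A → sumTo (suc A) (λ n → t n A))
Counted-Σ {X} {w} n≤w c = counted λ A → Count-↔ (collect A)
  (Count-sumTo (suc A) (λ n → Fiber (w n) A) λ n _ → count (c n) A)
  where
  collect : ∀ A → (Σ ℕ λ n → n < suc A × Fiber (w n) A) ↔ Fiber (Σʷ {X} w) A
  collect A = mk↔ₛ′ (λ (n , _ , x , p) → (n , x) , p)
    (λ ((n , x) , p) → n , s≤s (subst (n ≤_) p (n≤w n x)) , x , p)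
    (λ _ → refl)
    (λ (n , _ , x , p) → cong (λ n≤A → n , n≤A , x , p) (ℕ.<-irrelevant _ _))

total : ∀ {X : Set} → (X → ℕ) → ∀ {n} → Vec X n → ℕ
total w []       = 0
total w (x ∷ xs) = w x ℕ.+ total w xs

Counted-Vec : ∀ {X : Set} {w : X → ℕ} {f} → Counted w f → ∀ n → Counted (total w {n}) (f ^ˢ n)
Counted-Vec c zero    = Counted-≅
  (weighted (mk↔ₛ′ (λ _ → []) (λ _ → tt) (λ { [] → refl }) (λ _ → refl)) λ _ → refl)
  (Counted-mono 0)
Counted-Vec {X} {w} c (suc n) = Counted-≅
  (weighted (mk↔ₛ′ (λ (xs , x) → x ∷ xs) uncons (λ { (x ∷ xs) → refl }) (λ _ → refl))
    λ (xs , x) → ℕ.+-comm (w x) (total w xs))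
  (Counted-× (Counted-Vec c n) c)
  where
  uncons : Vec X (suc n) → Vec X n × X
  uncons (x ∷ xs) = xs , x

Counted-shift : ∀ {X : Set} {w : X → ℕ} {f} k → Counted w f → Counted (λ x → k ℕ.+ w x) (mono k *ˢ f)
Counted-shift k c = Counted-≅
  (weighted (mk↔ₛ′ proj₂ (tt ,_) (λ _ → refl) (λ _ → refl)) λ _ → refl)
  (Counted-× (Counted-mono k) c)

-- A class X ≅ Y + Z × X with Z of positive weight is Y followed by a sequence of Zs.
Counted-geo : ∀ {X Y Z : Set} {u : X → ℕ} {v : Y → ℕ} {w : Z → ℕ} {g h} →
              u ≅ [ v , w +ʷ u ]′ → (∀ z → 0 < w z) → h ≈[ 1 ] 0ˢ →
              Counted v g → Counted w h → Counted u (g *ˢ geo h)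
Counted-geo {u = u} {v} {w} {g} {h} i 0<w h₀ c d = counted (<-rec _ step)
  where
  f = g *ˢ geo h
  unfold : f ≈ g +ˢ h *ˢ f
  unfold = ≈-trans
    (solve 3 (λ g h s → g :* s := g :* ((con 1ℤ :- h) :* s) :+ h :* (g :* s)) ≈-refl g h (geo h))
    (+ˢ-cong (≈-trans (*ˢ-cong (≈-refl {g}) (geo-inverse h₀)) (S.*-identityʳ g)) (≈-refl {h *ˢ f}))
  step : ∀ A → (∀ {B} → B < A → Count (f B) (Fiber u B)) → Count (f A) (Fiber u A)
  step A rec = Count-≡ (sym (at unfold A)) (Count-↔ (Fiber-↔ (≅-sym i)) (Count-↔ Fiber-⊎
    (Count-⊎ (count c A) (Count-↔ Fiber-× (Count-sumTo (suc A) (λ k → Fiber w k × Fiber u (A ∸ k)) term)))))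
    where
    term : ∀ k → k < suc A → Count (h k ℤ.* f (A ∸ k)) (Fiber w k × Fiber u (A ∸ k))
    -- The summand k = 0 would call the recursion at A itself. It is empty because no Z has weight
    -- 0, in accordance with h(0) = 0.
    term zero    _   = Count-≡ (sym (trans (cong (ℤ._* f A) (below h₀ 0 z<s)) (ℤ.*-zeroˡ (f A))))
      (Count-empty λ ((z , p) , _) → ℕ.<⇒≢ (0<w z) (sym p))
    term (suc k) k<A = Count-× (count d (suc k)) (rec (ℕ.∸-monoʳ-< z<s (ℕ.≤-pred k<A)))

-- Partitions, with children attached to the parts

geoFactor : Series → ℕ → Series
geoFactor G i = geo (mono i *ˢ G)

-- Here the factor of lowest index is multiplied last, the order in which `Counted-Ascent` and
-- `Counted-Rows` produce factors; `prod1` grows the other way.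
prodFrom : (ℕ → Series) → ℕ → ℕ → Series
prodFrom s n zero    = 1ˢ
prodFrom s n (suc l) = prodFrom s (suc n) l *ˢ s n

prod1-prodFrom : ∀ s n l → prod1 n s *ˢ prodFrom s (suc n) l ≈ prod1 (n ℕ.+ l) s
prod1-prodFrom s n zero rewrite ℕ.+-identityʳ n = S.*-identityʳ (prod1 n s)
prod1-prodFrom s n (suc l) rewrite ℕ.+-suc n l = ≈-trans
  (solve 3 (λ p f x → p :* (f :* x) := p :* x :* f) ≈-refl
    (prod1 n s) (prodFrom s (suc (suc n)) l) (s (suc n)))
  (prod1-prodFrom s (suc n) l)

prodFrom≈prod1 : ∀ s l → prodFrom s 1 l ≈ prod1 l s
prodFrom≈prod1 s l = ≈-trans (≈-sym (*ˢ-identityˡ (prodFrom s 1 l))) (prod1-prodFrom s 0 l)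

-- The bound n acts as a virtual first part, as the peak does in `right-dec` of a stack.
Parts : ℕ → Set
Parts n = Σ (List ℕ) λ xs → All (0 <_) xs × Linked _≥_ (n ∷ xs)

partsSum : ∀ {n} → Parts n → ℕ
partsSum (xs , _) = sum xs

Parts-≡ : ∀ {n} {x y : Parts n} → proj₁ x ≡ proj₁ y → x ≡ y
Parts-≡ {x = xs , p , q} {_ , p′ , q′} refl = cong₂ (λ p q → xs , p , q)
  (All.irrelevant ℕ.<-irrelevant p p′) (Linked.irrelevant ℕ.≤-irrelevant q q′)

Parts-0 : (λ (_ : ⊤) → 0) ≅ partsSum {0}
Parts-0 = weighted (mk↔ₛ′ (λ _ → [] , [] , [-]) (λ _ → tt)
  (λ { ([] , _) → Parts-≡ refl ; (_ ∷ _ , z<s ∷ _ , () ∷ _) }) (λ _ → refl)) λ _ → refl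

-- Peeling off one part of the maximal size.
Parts-suc : ∀ n → partsSum {suc n} ≅ [ partsSum {n} , (λ (_ : ⊤) → suc n) +ʷ partsSum {suc n} ]′
Parts-suc n = weighted (mk↔ₛ′ to from to∘from from∘to) weight-to
  where
  Y = Parts n ⊎ (⊤ × Parts (suc n))
  to-head : ∀ {x xs} → x < suc n ⊎ x ≡ suc n → All (0 <_) (x ∷ xs) → Linked _≥_ (x ∷ xs) → Y
  to-head (inj₁ x≤n)  p       q = inj₁ (_ , p , ℕ.≤-pred x≤n ∷ q)
  to-head (inj₂ refl) (_ ∷ p) q = inj₂ (tt , _ , p , q)
  to : Parts (suc n) → Y
  to ([] , _)             = inj₁ ([] , [] , [-])
  to (x ∷ xs , p , r ∷ q) = to-head (ℕ.m≤n⇒m<n∨m≡n r) p q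
  from : Y → Parts (suc n)
  from (inj₁ ([] , _))             = [] , [] , [-]
  from (inj₁ (x ∷ xs , p , r ∷ q)) = x ∷ xs , p , ℕ.m≤n⇒m≤1+n r ∷ q
  from (inj₂ (tt , xs , p , q))    = suc n ∷ xs , z<s ∷ p , ℕ.≤-refl ∷ q
  to∘from : ∀ y → to (from y) ≡ y
  to∘from (inj₁ ([] , _)) = cong inj₁ (Parts-≡ refl)
  to∘from (inj₁ (x ∷ xs , p , r ∷ q)) with ℕ.m≤n⇒m<n∨m≡n (ℕ.m≤n⇒m≤1+n r)
  ... | inj₁ _    = cong inj₁ (Parts-≡ refl)
  ... | inj₂ refl = ⊥-elim (ℕ.<-irrefl refl r)
  to∘from (inj₂ (tt , xs , p , q)) with ℕ.m≤n⇒m<n∨m≡n (ℕ.≤-refl {suc n})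
  ... | inj₁ n<n  = ⊥-elim (ℕ.<-irrefl refl n<n)
  ... | inj₂ refl = refl
  from∘to : ∀ x → from (to x) ≡ x
  from∘to ([] , _) = Parts-≡ refl
  from∘to (x ∷ xs , p , r ∷ q) with ℕ.m≤n⇒m<n∨m≡n r
  from∘to (x ∷ xs , p , r ∷ q)     | inj₁ _ = Parts-≡ refl
  from∘to (x ∷ xs , _ ∷ p , r ∷ q) | inj₂ refl = Parts-≡ refl
  weight-to : ∀ x → [ partsSum {n} , (λ (_ : ⊤) → suc n) +ʷ partsSum {suc n} ]′ (to x) ≡ partsSum x
  weight-to ([] , _) = refl
  weight-to (x ∷ xs , p , r ∷ q) with ℕ.m≤n⇒m<n∨m≡n r
  weight-to (x ∷ xs , p , r ∷ q)     | inj₁ _ = refl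
  weight-to (x ∷ xs , _ ∷ p , r ∷ q) | inj₂ refl = refl

Counted-Parts : ∀ n → Counted (partsSum {n}) (invQPoch n)
Counted-Parts zero    = Counted-≅ Parts-0 (Counted-mono 0)
Counted-Parts (suc n) = Counted-geo (Parts-suc n) (λ _ → z<s) (mono-suc-vanish n)
  (Counted-Parts n) (Counted-mono (suc n))

-- Weakly increasing lists with entries in [m, u), each entry carrying a child.
Ascent : Set → ℕ → ℕ → Set
Ascent Child m u = Σ (List ℕ) λ xs → (Linked _≤_ (m ∷ xs) × All (_< u) xs) × Vec Child (length xs)

Ascent-≡ : ∀ {Child m u xs} {p p′ : Linked _≤_ (m ∷ xs) × All (_< u) xs} {cs} →
           _≡_ {A = Ascent Child m u} (xs , p , cs) (xs , p′ , cs)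
Ascent-≡ {xs = xs} {p , q} {p′ , q′} {cs} = cong₂ (λ p q → xs , (p , q) , cs)
  (Linked.irrelevant ℕ.≤-irrelevant p p′) (All.irrelevant ℕ.<-irrelevant q q′)

module _ {Child : Set} (w : Child → ℕ) where

  ascentWeight : ∀ {m u} → Ascent Child m u → ℕ
  ascentWeight (xs , _ , cs) = sum xs ℕ.+ total w cs

  Ascent-empty : ∀ u → (λ (_ : ⊤) → 0) ≅ ascentWeight {u} {u}
  Ascent-empty u = weighted (mk↔ₛ′ (λ _ → [] , ([-] , []) , []) (λ _ → tt) to∘from (λ _ → refl)) λ _ → refl
    where
    to∘from : ∀ (a : Ascent Child u u) → ([] , ([-] , []) , []) ≡ a
    to∘from ([] , _ , [])                    = Ascent-≡
    to∘from (_ ∷ _ , (u≤x ∷ _ , x<u ∷ _) , _) = ⊥-elim (ℕ.<⇒≱ x<u u≤x)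

  -- Peeling off one entry of the minimal size.
  Ascent-suc : ∀ {m u} → m < u →
               ascentWeight {m} {u} ≅ [ ascentWeight {suc m} {u} , (λ c → m ℕ.+ w c) +ʷ ascentWeight {m} {u} ]′
  Ascent-suc {m} {u} m<u = weighted (mk↔ₛ′ to from to∘from from∘to) weight-to
    where
    Y = Ascent Child (suc m) u ⊎ (Child × Ascent Child m u)
    to-head : ∀ {x xs} → m < x ⊎ m ≡ x → Linked _≤_ (x ∷ xs) → All (_< u) (x ∷ xs) →
              Vec Child (suc (length xs)) → Y
    to-head (inj₁ m<x)  p q       cs       = inj₁ (_ , (m<x ∷ p , q) , cs)
    to-head (inj₂ refl) p (_ ∷ q) (c ∷ cs) = inj₂ (c , _ , (p , q) , cs)
    to : Ascent Child m u → Y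
    to ([] , _ , [])                = inj₁ ([] , ([-] , []) , [])
    to (x ∷ xs , (r ∷ p , q) , cs) = to-head (ℕ.m≤n⇒m<n∨m≡n r) p q cs
    from : Y → Ascent Child m u
    from (inj₁ ([] , _ , []))              = [] , ([-] , []) , []
    from (inj₁ (x ∷ xs , (r ∷ p , q) , cs)) = x ∷ xs , (ℕ.<⇒≤ r ∷ p , q) , cs
    from (inj₂ (c , xs , (p , q) , cs))     = m ∷ xs , (ℕ.≤-refl ∷ p , m<u ∷ q) , c ∷ cs
    to∘from : ∀ y → to (from y) ≡ y
    to∘from (inj₁ ([] , _ , [])) = cong inj₁ Ascent-≡
    to∘from (inj₁ (x ∷ xs , (r ∷ p , q) , cs)) with ℕ.m≤n⇒m<n∨m≡n (ℕ.<⇒≤ r)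
    ... | inj₁ _    = cong inj₁ Ascent-≡
    ... | inj₂ refl = ⊥-elim (ℕ.<-irrefl refl r)
    to∘from (inj₂ (c , xs , (p , q) , cs)) with ℕ.m≤n⇒m<n∨m≡n (ℕ.≤-refl {m})
    ... | inj₁ m<m  = ⊥-elim (ℕ.<-irrefl refl m<m)
    ... | inj₂ refl = refl
    from∘to : ∀ x → from (to x) ≡ x
    from∘to ([] , _ , []) = Ascent-≡
    from∘to (x ∷ xs , (r ∷ p , q) , cs) with ℕ.m≤n⇒m<n∨m≡n r
    from∘to (x ∷ xs , (r ∷ p , q) , cs)         | inj₁ _    = Ascent-≡
    from∘to (x ∷ xs , (r ∷ p , _ ∷ q) , c ∷ cs) | inj₂ refl = Ascent-≡
    lem : ∀ a b c d → (a ℕ.+ b) ℕ.+ (c ℕ.+ d) ≡ (a ℕ.+ c) ℕ.+ (b ℕ.+ d)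
    lem = solveℕ-∀
    weight-to : ∀ x → [ ascentWeight {suc m} {u} , (λ c → m ℕ.+ w c) +ʷ ascentWeight {m} {u} ]′ (to x) ≡ ascentWeight x
    weight-to ([] , _ , []) = refl
    weight-to (x ∷ xs , (r ∷ p , q) , cs) with ℕ.m≤n⇒m<n∨m≡n r
    weight-to (x ∷ xs , (r ∷ p , q) , cs)         | inj₁ _    = refl
    weight-to (x ∷ xs , (r ∷ p , _ ∷ q) , c ∷ cs) | inj₂ refl = lem x (w c) (sum xs) (total w cs)

  module _ {G : Series} (c : Counted w G) where

    -- Each of the l available values i may be repeated freely, every copy with its own child, hence
    -- a factor 1/(1 - q^i G). Starting at `suc m` keeps the peeled weight positive.
    Counted-Ascent : ∀ l {m u} → suc m ℕ.+ l ≡ u → Counted (ascentWeight {suc m} {u}) (prodFrom (geoFactor G) (suc m) l)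
    Counted-Ascent zero {m} refl rewrite ℕ.+-identityʳ m = Counted-≅ (Ascent-empty (suc m)) (Counted-mono 0)
    Counted-Ascent (suc l) {m} {u} e = Counted-geo
      (Ascent-suc (subst (suc m <_) e (ℕ.m<m+n (suc m) z<s))) (λ _ → z<s)
      (*ˢ-vanishˡ {g = G} (mono-suc-vanish m))
      (Counted-Ascent l (trans (sym (ℕ.+-suc (suc m) l)) e)) (Counted-shift (suc m) c)

-- Enriched stacks and Ferrers diagrams

Enriched : Set → Bool → Set
Enriched Child b = Σ (Obj b) λ r → Vec Child (size b r)

-- A stack stores positivity and monotonicity of its left part separately; `Ascent` merges them by a
-- virtual first entry 1. This lemma and the next convert between the two.
linked-cons : ∀ {m xs} → All (m ≤_) xs → Linked _≤_ xs → Linked _≤_ (m ∷ xs)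
linked-cons []      _ = [-]
linked-cons (r ∷ _) p = r ∷ p

linked-positive : ∀ {m xs} → Linked _≤_ (suc m ∷ xs) → All (0 <_) xs
linked-positive [-]                          = []
linked-positive (_∷_ {y = suc _} r p) = z<s ∷ linked-positive p

-- Stacks of peak n + 1.
PeakStack : Set → ℕ → Set
PeakStack Child n = Parts (suc n) × Ascent Child 1 (suc n)

stack-≡ : ∀ {Child : Set} {l p r} {lp lp′ : All (0 <_) l} {pp pp′ : 0 < p} {rp rp′ : All (0 <_) r}
          {li li′ : Linked _≤_ l} {ll ll′ : All (_< p) l} {rd rd′ : Linked _≥_ (p ∷ r)} {cs : Vec Child (length l)} →
          _≡_ {A = Enriched Child false}
          (just record { left = l ; peak = p ; right = r ; left-pos = lp ; peak-pos = pp ; right-pos = rp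
                       ; left-inc = li ; left-lt = ll ; right-dec = rd } , cs)
          (just record { left = l ; peak = p ; right = r ; left-pos = lp′ ; peak-pos = pp′ ; right-pos = rp′
                       ; left-inc = li′ ; left-lt = ll′ ; right-dec = rd′ } , cs)
stack-≡ {lp = lp} {lp′} {pp} {pp′} {rp} {rp′} {li} {li′} {ll} {ll′} {rd} {rd′}
  with refl ← All.irrelevant ℕ.<-irrelevant lp lp′
     | refl ← ℕ.<-irrelevant pp pp′
     | refl ← All.irrelevant ℕ.<-irrelevant rp rp′
     | refl ← Linked.irrelevant ℕ.≤-irrelevant li li′
     | refl ← All.irrelevant ℕ.<-irrelevant ll ll′
     | refl ← Linked.irrelevant ℕ.≤-irrelevant rd rd′ = refl

-- A relational `lookup` with a plain number as position: when the top row is removed, the position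
-- drops by one and the value stays.
data At : List ℕ → ℕ → ℕ → Set where
  here  : ∀ {n xs} → At (n ∷ xs) 0 n
  there : ∀ {x xs k n} → At xs k n → At (x ∷ xs) (suc k) n

At-irrelevant : ∀ {xs k n} (p q : At xs k n) → p ≡ q
At-irrelevant here      here      = refl
At-irrelevant (there p) (there q) = cong there (At-irrelevant p q)

At-bound : ∀ {x xs k n} → Linked _≥_ (x ∷ xs) → At (x ∷ xs) k n → n ≤ x
At-bound _       here      = ℕ.≤-refl
At-bound (r ∷ p) (there a) = ℕ.≤-trans (At-bound p a) r

lookup⇒At : ∀ xs (i : Fin (length xs)) {n} → lookup xs i ≡ n → At xs (toℕ i) n
lookup⇒At (x ∷ xs) zero    refl = here
lookup⇒At (x ∷ xs) (suc i) e    = there (lookup⇒At xs i e)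

At⇒lookup : ∀ {xs k n} → At xs k n → Σ (Fin (length xs)) λ i → toℕ i ≡ k × lookup xs i ≡ n
At⇒lookup here = zero , refl , refl
At⇒lookup (there a) with At⇒lookup a
... | i , refl , e = suc i , refl , e

-- The rows x ∷ xs of a Ferrers diagram from a certain row on, where the k-th of them (from 0)
-- has length n and each of the x columns carries a child.
Rows : Set → ℕ → ℕ → Set
Rows Child k n = Σ ℕ λ x → Σ (List ℕ) λ xs →
  (Linked _≥_ (x ∷ xs) × All (0 <_) (x ∷ xs) × At (x ∷ xs) k n) × Vec Child x

Rows-≡ : ∀ {Child k n x xs} {p p′ : Linked _≥_ (x ∷ xs) × All (0 <_) (x ∷ xs) × At (x ∷ xs) k n} {cs} →
         _≡_ {A = Rows Child k n} (x , xs , p , cs) (x , xs , p′ , cs)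
Rows-≡ {p = p , q , a} {p′ , q′ , a′}
  with refl ← Linked.irrelevant ℕ.≤-irrelevant p p′
     | refl ← All.irrelevant ℕ.<-irrelevant q q′
     | refl ← At-irrelevant a a′ = refl

DurfeeRows : Set → ℕ → Set
DurfeeRows Child k = Rows Child k (suc k)

ferrers-≡ : ∀ {xs} {ne ne′ : 0 < length xs} {p p′ : All (0 <_) xs} {d d′ : Linked _≥_ xs}
            {i i′ : ∃ λ (i : Fin (length xs)) → lookup xs i ≡ suc (toℕ i)} → toℕ (proj₁ i) ≡ toℕ (proj₁ i′) →
            _≡_ {A = Ferrers}
            record { rows = xs ; nonempty = ne ; pos = p ; dec = d ; durfee = i }
            record { rows = xs ; nonempty = ne′ ; pos = p′ ; dec = d′ ; durfee = i′ }
ferrers-≡ {ne = ne} {ne′} {p} {p′} {d} {d′} {i , e} {i′ , e′} i≡i′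
  with refl ← ℕ.<-irrelevant ne ne′
     | refl ← All.irrelevant ℕ.<-irrelevant p p′
     | refl ← Linked.irrelevant ℕ.≤-irrelevant d d′
     | refl ← Fin.toℕ-injective i≡i′
  with refl ← ℕ.≡-irrelevant e e′ = refl

module _ {Child : Set} (w : Child → ℕ) where

  enrichedWeight : ∀ b → Enriched Child b → ℕ
  enrichedWeight b (r , cs) = objArea b r ℕ.+ total w cs

  peakStackWeight : ∀ n → PeakStack Child n → ℕ
  peakStackWeight n = (λ p → suc n ℕ.+ partsSum p) +ʷ ascentWeight w

  Enriched-stack : enrichedWeight false ≅ [ (λ (_ : ⊤) → 0) , Σʷ {PeakStack Child} peakStackWeight ]′
  Enriched-stack = weighted (mk↔ₛ′ to from to∘from from∘to) weight-to
    where
    to : Enriched Child false → ⊤ ⊎ Σ ℕ (PeakStack Child)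
    to (nothing , [])                        = inj₁ tt
    to (just record { peak = suc n ; right = r ; left-pos = lp ; right-pos = rp
                    ; left-inc = li ; left-lt = ll ; right-dec = rd } , cs) =
      inj₂ (n , (r , rp , rd) , (_ , (linked-cons lp li , ll) , cs))
    from : ⊤ ⊎ Σ ℕ (PeakStack Child) → Enriched Child false
    from (inj₁ tt) = nothing , []
    from (inj₂ (n , (r , rp , rd) , (l , (li , ll) , cs))) =
      just record { left = l ; peak = suc n ; right = r ; left-pos = linked-positive li ; peak-pos = z<s
                  ; right-pos = rp ; left-inc = Linked.tail li ; left-lt = ll ; right-dec = rd } , cs
    to∘from : ∀ y → to (from y) ≡ y
    to∘from (inj₁ tt) = refl
    to∘from (inj₂ (n , r , a)) = cong (λ a → inj₂ (n , r , a)) Ascent-≡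
    from∘to : ∀ x → from (to x) ≡ x
    from∘to (nothing , [])                = refl
    from∘to (just record { peak = suc n } , cs) = stack-≡
    lem : ∀ p r l t → (p ℕ.+ r) ℕ.+ (l ℕ.+ t) ≡ (l ℕ.+ p ℕ.+ r) ℕ.+ t
    lem = solveℕ-∀
    weight-to : ∀ x → [ (λ (_ : ⊤) → 0) , Σʷ {PeakStack Child} peakStackWeight ]′ (to x) ≡ enrichedWeight false x
    weight-to (nothing , [])                       = refl
    weight-to (just record { left = l ; peak = suc n ; right = r } , cs) =
      lem (suc n) (sum r) (sum l) (total w cs)

  -- j is the number of rows that have been removed from the top.
  rowsWeight : ∀ j {k n} → Rows Child k n → ℕ
  rowsWeight j (x , xs , _ , cs) = (j ℕ.* x ℕ.+ (x ℕ.+ sum xs)) ℕ.+ total w cs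

  -- If the first two rows are equal, the top row can be removed; otherwise
  -- the last column has height one (plus the j removed cells) and can be removed.
  Rows-suc : ∀ j {k n} →
             rowsWeight j {suc k} {n} ≅ [ rowsWeight (suc j) {k} {n} , (λ c → suc j ℕ.+ w c) +ʷ rowsWeight j {suc k} {n} ]′
  Rows-suc j {k} {n} = weighted (mk↔ₛ′ to from to∘from from∘to) weight-to
    where
    Y = Rows Child k n ⊎ (Child × Rows Child (suc k) n)
    to-head : ∀ {x y ys} → y < x ⊎ y ≡ x → Linked _≥_ (y ∷ ys) → All (0 <_) (y ∷ ys) →
              At (y ∷ ys) k n → Vec Child x → Y
    -- Any fixed matching of children with columns will do; the removed column takes the head of the
    -- vector.
    to-head (inj₁ (s≤s r)) p q a (c ∷ cs) = inj₂ (c , _ , _ , (r ∷ p , ℕ.<-≤-trans (All.head q) r ∷ q , there a) , cs)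
    to-head (inj₂ refl)    p q a cs       = inj₁ (_ , _ , (p , q , a) , cs)
    to : Rows Child (suc k) n → Y
    to (x , y ∷ ys , (r ∷ p , _ ∷ q , there a) , cs) = to-head (ℕ.m≤n⇒m<n∨m≡n r) p q a cs
    from : Y → Rows Child (suc k) n
    from (inj₁ (x , xs , (p , q , a) , cs)) = x , x ∷ xs , (ℕ.≤-refl ∷ p , All.head q ∷ q , there a) , cs
    from (inj₂ (c , x , y ∷ ys , (r ∷ p , _ ∷ q , there a) , cs)) =
      suc x , y ∷ ys , (ℕ.m≤n⇒m≤1+n r ∷ p , z<s ∷ q , there a) , c ∷ cs
    to∘from : ∀ y → to (from y) ≡ y
    to∘from (inj₁ (x , xs , (p , q , a) , cs)) with ℕ.m≤n⇒m<n∨m≡n (ℕ.≤-refl {x})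
    ... | inj₁ x<x  = ⊥-elim (ℕ.<-irrefl refl x<x)
    ... | inj₂ refl = refl
    to∘from (inj₂ (c , x , y ∷ ys , (r ∷ p , _ ∷ q , there a) , cs)) with ℕ.m≤n⇒m<n∨m≡n (ℕ.m≤n⇒m≤1+n r)
    ... | inj₁ (s≤s _) = cong (λ z → inj₂ (c , z)) Rows-≡
    ... | inj₂ refl    = ⊥-elim (ℕ.<-irrefl refl r)
    from∘to : ∀ x → from (to x) ≡ x
    from∘to (x , y ∷ ys , (r ∷ p , _ ∷ q , there a) , cs) with ℕ.m≤n⇒m<n∨m≡n r
    from∘to (x , y ∷ ys , (r ∷ p , _ ∷ q , there a) , c ∷ cs) | inj₁ (s≤s _) = Rows-≡
    from∘to (x , y ∷ ys , (r ∷ p , _ ∷ q , there a) , cs)     | inj₂ refl    = Rows-≡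
    column : ∀ j c x s t → (suc j ℕ.+ c) ℕ.+ ((j ℕ.* x ℕ.+ (x ℕ.+ s)) ℕ.+ t) ≡
                           (j ℕ.* suc x ℕ.+ (suc x ℕ.+ s)) ℕ.+ (c ℕ.+ t)
    column = solveℕ-∀
    row : ∀ j x s t → (suc j ℕ.* x ℕ.+ (x ℕ.+ s)) ℕ.+ t ≡ (j ℕ.* x ℕ.+ (x ℕ.+ (x ℕ.+ s))) ℕ.+ t
    row = solveℕ-∀
    weight-to : ∀ x → [ rowsWeight (suc j) , (λ c → suc j ℕ.+ w c) +ʷ rowsWeight j ]′ (to x) ≡ rowsWeight j x
    weight-to (x , y ∷ ys , (r ∷ p , _ ∷ q , there a) , cs) with ℕ.m≤n⇒m<n∨m≡n r
    weight-to (suc x , y ∷ ys , (r ∷ p , _ ∷ q , there a) , c ∷ cs) | inj₁ (s≤s _) =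
      column j (w c) x (y ℕ.+ sum ys) (total w cs)
    weight-to (x , y ∷ ys , (r ∷ p , _ ∷ q , there a) , cs)         | inj₂ refl    = row j x (sum ys) (total w cs)

  Rows-0 : ∀ j → ((total w {suc j} +ʷ (λ (_ : ⊤) → suc j ℕ.* suc j)) +ʷ partsSum {suc j}) ≅ rowsWeight j {0} {suc j}
  Rows-0 j = weighted (mk↔ₛ′ to from to∘from (λ _ → cong (_ ,_) (Parts-≡ refl))) weight-to
    where
    to : (Vec Child (suc j) × ⊤) × Parts (suc j) → Rows Child 0 (suc j)
    to ((cs , _) , (xs , p , q)) = suc j , xs , (q , z<s ∷ p , here) , cs
    from : Rows Child 0 (suc j) → (Vec Child (suc j) × ⊤) × Parts (suc j)
    from (_ , xs , (q , _ ∷ p , here) , cs) = (cs , tt) , (xs , p , q)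
    to∘from : ∀ x → to (from x) ≡ x
    to∘from (_ , xs , (q , _ ∷ p , here) , cs) = Rows-≡
    lem : ∀ j s t → (j ℕ.* suc j ℕ.+ (suc j ℕ.+ s)) ℕ.+ t ≡ (t ℕ.+ suc j ℕ.* suc j) ℕ.+ s
    lem = solveℕ-∀
    weight-to : ∀ x → rowsWeight j (to x) ≡ ((total w {suc j} +ʷ (λ (_ : ⊤) → suc j ℕ.* suc j)) +ʷ partsSum {suc j}) x
    weight-to ((cs , _) , (xs , _)) = lem j (sum xs) (total w cs)

  Rows-width : ∀ {k n} (x : Rows Child k n) → n ≤ rowsWeight 0 x
  Rows-width (x , xs , (p , _ , a) , cs) = ℕ.≤-trans (At-bound p a)
    (ℕ.≤-trans (ℕ.m≤m+n x (sum xs)) (ℕ.m≤m+n (x ℕ.+ sum xs) (total w cs)))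

  durfeeRowsWeight : ∀ k → DurfeeRows Child k → ℕ
  durfeeRowsWeight k = rowsWeight 0

  Enriched-ferrers : enrichedWeight true ≅ [ (λ (_ : ⊤) → 0) , Σʷ {DurfeeRows Child} durfeeRowsWeight ]′
  Enriched-ferrers = weighted (mk↔ₛ′ to from to∘from from∘to) weight-to
    where
    to : Enriched Child true → ⊤ ⊎ Σ ℕ (DurfeeRows Child)
    to (nothing , []) = inj₁ tt
    to (just record { rows = x ∷ xs ; pos = p ; dec = d ; durfee = i , e } , cs) =
      inj₂ (toℕ i , x , xs , (d , p , lookup⇒At (x ∷ xs) i e) , cs)
    diagram : ∀ {k x xs} → Linked _≥_ (x ∷ xs) → All (0 <_) (x ∷ xs) →
              (Σ (Fin (suc (length xs))) λ i → toℕ i ≡ k × lookup (x ∷ xs) i ≡ suc k) → Ferrers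
    diagram {k} {x} {xs} d p (i , i≡k , e) = record
      { rows = x ∷ xs ; nonempty = z<s ; pos = p ; dec = d ; durfee = i , trans e (cong suc (sym i≡k)) }
    from : ⊤ ⊎ Σ ℕ (DurfeeRows Child) → Enriched Child true
    from (inj₁ tt) = nothing , []
    from (inj₂ (k , x , xs , (d , p , a) , cs)) = just (diagram d p (At⇒lookup a)) , cs
    to∘from : ∀ y → to (from y) ≡ y
    to∘from (inj₁ tt) = refl
    to∘from (inj₂ (k , x , xs , (d , p , a) , cs)) with At⇒lookup a
    ... | i , refl , e = cong (λ r → inj₂ (k , r)) Rows-≡
    from∘to : ∀ x → from (to x) ≡ x
    from∘to (nothing , []) = refl
    from∘to (just record { rows = x ∷ xs ; pos = p ; dec = d ; durfee = i , e } , cs) =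
      enrich (ferrers-≡ (proj₁ (proj₂ (At⇒lookup (lookup⇒At (x ∷ xs) i e)))))
      where
      enrich : ∀ {d d′ : Linked _≥_ (x ∷ xs)} {p p′ : All (0 <_) (x ∷ xs)} {n n′ i i′} →
               _≡_ {A = Ferrers} record { rows = x ∷ xs ; nonempty = n ; pos = p ; dec = d ; durfee = i }
                                 record { rows = x ∷ xs ; nonempty = n′ ; pos = p′ ; dec = d′ ; durfee = i′ } →
               _≡_ {A = Enriched Child true}
                 (just record { rows = x ∷ xs ; nonempty = n ; pos = p ; dec = d ; durfee = i } , cs)
                 (just record { rows = x ∷ xs ; nonempty = n′ ; pos = p′ ; dec = d′ ; durfee = i′ } , cs)
      enrich refl = refl
    weight-to : ∀ x → [ (λ (_ : ⊤) → 0) , Σʷ {DurfeeRows Child} durfeeRowsWeight ]′ (to x) ≡ enrichedWeight true x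
    weight-to (nothing , []) = refl
    weight-to (just record { rows = x ∷ xs } , cs) = refl

  module _ {G : Series} (c : Counted w G) where

    -- Here n is the side of the Durfee square, j rows are removed and k still lie above its bottom
    -- row. A column ending at the current top row has j + 1 cells, giving 1/(1 - q^{j+1} G). At k =
    -- 0 the top row has length n = j + 1, and only the square and the partition below it remain.
    Counted-Rows : ∀ k j {n} → j ℕ.+ suc k ≡ n → Counted (rowsWeight j {k} {n})
      ((G ^ˢ n *ˢ mono (n ℕ.* n)) *ˢ invQPoch n *ˢ prodFrom (geoFactor G) (suc j) k)
    Counted-Rows zero j refl rewrite ℕ.+-comm j 1 = Counted-≈
      (≈-sym (S.*-identityʳ ((G ^ˢ suc j *ˢ mono (suc j ℕ.* suc j)) *ˢ invQPoch (suc j))))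
      (Counted-≅ (Rows-0 j) (Counted-× (Counted-× (Counted-Vec c (suc j)) (Counted-mono (suc j ℕ.* suc j)))
        (Counted-Parts (suc j))))
    Counted-Rows (suc k) j {n} e = Counted-≈
      (S.*-assoc ((G ^ˢ n *ˢ mono (n ℕ.* n)) *ˢ invQPoch n) (prodFrom (geoFactor G) (suc (suc j)) k)
        (geoFactor G (suc j)))
      (Counted-geo (Rows-suc j) (λ _ → z<s) (*ˢ-vanishˡ {g = G} (mono-suc-vanish j))
        (Counted-Rows k (suc j) (trans (sym (ℕ.+-suc j (suc k))) e)) (Counted-shift (suc j) c))

    Counted-PeakStack : ∀ n → Counted (peakStackWeight n) (termF false G (suc n))
    Counted-PeakStack n = Counted-× (Counted-shift (suc n) (Counted-Parts (suc n)))
      (Counted-≈ (prodFrom≈prod1 (geoFactor G) n) (Counted-Ascent w c n refl))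

    Counted-DurfeeRows : ∀ k → Counted (durfeeRowsWeight k) (termF true G (suc k))
    Counted-DurfeeRows k = Counted-≈
      (*ˢ-cong (≈-refl {(G ^ˢ suc k *ˢ mono (suc k ℕ.* suc k)) *ˢ invQPoch (suc k)}) (prodFrom≈prod1 (geoFactor G) k))
      (Counted-Rows k 0 refl)

    Counted-sum : ∀ b {X : ℕ → Set} {v : ∀ n → X n → ℕ} → (∀ n x → n ≤ v n x) →
                  (∀ n → Counted (v n) (termF b G (suc n))) → Counted [ (λ (_ : ⊤) → 0) , Σʷ {X} v ]′ (Fq b G)
    Counted-sum b {X} {v} n≤v d = Counted-≈ (ptw λ m → sym (Fq-coeff b G m))
      (Counted-⊎ (Counted-mono 0) (Counted-Σ {X} {v} {λ i → termF b G (suc i)} n≤v d))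

    -- The substitution a = G: the size marked by a is the number of children, each counted by G.
    Counted-Enriched : ∀ b → Counted (enrichedWeight b) (Fq b G)
    Counted-Enriched false = Counted-≅ (≅-sym Enriched-stack) (Counted-sum false
      (λ n (p , a) → ℕ.≤-trans (ℕ.n≤1+n n) (ℕ.≤-trans (ℕ.m≤m+n (suc n) (partsSum p)) (ℕ.m≤m+n (suc n ℕ.+ partsSum p) (ascentWeight w a))))
      Counted-PeakStack)
    Counted-Enriched true = Counted-≅ (≅-sym Enriched-ferrers) (Counted-sum true
      (λ k x → ℕ.≤-trans (ℕ.n≤1+n k) (Rows-width x)) Counted-DurfeeRows)

-- Trees

module _ {σ : ℕ → Bool} where

  -- The strict bound makes the class empty for N = 0, matching the value 0 at which the composition
  -- starts.
  Bounded : ℕ → ℕ → Set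
  Bounded N ℓ = Σ (Tree σ ℓ) λ T → height T < N

  boundedArea : ∀ {N ℓ} → Bounded N ℓ → ℕ
  boundedArea (T , _) = area T

  Bounded-≡ : ∀ {N ℓ} {T T′ : Bounded N ℓ} → proj₁ T ≡ proj₁ T′ → T ≡ T′
  Bounded-≡ {T = T , p} {_ , p′} refl = cong (T ,_) (ℕ.<-irrelevant p p′)

  restrict : ∀ {N ℓ n} (ts : Vec (Tree σ ℓ) n) → heightV ts ≤ N → Vec (Bounded N ℓ) n
  restrict []       _ = []
  restrict (t ∷ ts) h = (t , ℕ.m⊔n≤o⇒m≤o _ (heightV ts) h) ∷ restrict ts (ℕ.m⊔n≤o⇒n≤o (suc (height t)) _ h)

  forget : ∀ {N ℓ n} → Vec (Bounded N ℓ) n → Vec (Tree σ ℓ) n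
  forget []             = []
  forget ((t , _) ∷ ts) = t ∷ forget ts

  forget-height : ∀ {N ℓ n} (ts : Vec (Bounded N ℓ) n) → heightV (forget ts) ≤ N
  forget-height []             = z≤n
  forget-height ((t , h) ∷ ts) = ℕ.⊔-lub h (forget-height ts)

  forget-restrict : ∀ {N ℓ n} (ts : Vec (Tree σ ℓ) n) (h : heightV ts ≤ N) → forget (restrict ts h) ≡ ts
  forget-restrict []       _ = refl
  forget-restrict (t ∷ ts) h = cong (t ∷_) (forget-restrict ts _)

  restrict-forget : ∀ {N ℓ n} (ts : Vec (Bounded N ℓ) n) (h : heightV (forget ts) ≤ N) → restrict (forget ts) h ≡ ts
  restrict-forget []       _ = refl
  restrict-forget (t ∷ ts) h = cong₂ _∷_ (Bounded-≡ refl) (restrict-forget ts _)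

  total-restrict : ∀ {N ℓ n} (ts : Vec (Tree σ ℓ) n) (h : heightV ts ≤ N) → total boundedArea (restrict ts h) ≡ areaV ts
  total-restrict []       _ = refl
  total-restrict (t ∷ ts) h = cong (area t ℕ.+_) (total-restrict ts _)

  Bounded-suc : ∀ N ℓ → boundedArea {suc N} {ℓ} ≅ enrichedWeight (boundedArea {N} {suc ℓ}) (σ ℓ)
  Bounded-suc N ℓ = weighted (mk↔ₛ′ to from
    (λ (r , ts) → cong (r ,_) (restrict-forget ts _))
    (λ { (node r ts , h) → Bounded-≡ (cong (node r) (forget-restrict ts _)) }))
    (λ { (node r ts , h) → cong (objArea (σ ℓ) r ℕ.+_) (total-restrict ts _) })
    where
    to : Bounded (suc N) ℓ → Enriched (Bounded N (suc ℓ)) (σ ℓ)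
    to (node r ts , h) = r , restrict ts (ℕ.≤-pred h)
    from : Enriched (Bounded N (suc ℓ)) (σ ℓ) → Bounded (suc N) ℓ
    from (r , ts) = node r (forget ts) , s≤s (forget-height ts)

  -- Passing to the children shifts the sequence in `xiSigma` but raises the level in `Tree`. The
  -- separate `τ`, pointwise equal to `σ` from level ℓ on, reconciles the two.
  Counted-Bounded : ∀ N ℓ τ → (∀ i → τ i ≡ σ (ℓ ℕ.+ i)) → Counted (boundedArea {suc N} {ℓ}) (xiSigma τ N)
  Counted-Bounded N ℓ τ e = Counted-≅ (≅-sym (Bounded-suc N ℓ)) (go N e)
    where
    root : τ 0 ≡ σ ℓ
    root = trans (e 0) (cong σ (ℕ.+-identityʳ ℓ))
    go : ∀ N → (∀ i → τ i ≡ σ (ℓ ℕ.+ i)) → Counted (enrichedWeight (boundedArea {N} {suc ℓ}) (σ ℓ)) (xiSigma τ N)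
    go zero    e = subst (λ b → Counted _ (Fq b 0ˢ)) (sym root)
      (Counted-Enriched boundedArea (Counted-empty λ ()) (σ ℓ))
    go (suc N) e = subst (λ b → Counted _ (Fq b (xiSigma (τ ∘ suc) N))) (sym root)
      (Counted-Enriched boundedArea
        (Counted-Bounded N (suc ℓ) (τ ∘ suc) λ i → trans (e (suc i)) (cong σ (ℕ.+-suc ℓ i))) (σ ℓ))

-- A vertex with children therefore carries positive area, so every edge of a longest path from the
-- root is paid for by its upper end.
empty-or-positive : ∀ b (r : Obj b) → size b r ≡ 0 ⊎ 0 < objArea b r
empty-or-positive false nothing  = inj₁ refl
empty-or-positive false (just s) = inj₂ (ℕ.≤-trans (Stack.peak-pos s)
  (ℕ.≤-trans (ℕ.m≤n+m _ (sum (Stack.left s))) (ℕ.m≤m+n _ (sum (Stack.right s)))))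
empty-or-positive true  nothing  = inj₁ refl
empty-or-positive true  (just record { rows = x ∷ xs ; pos = 0<x ∷ _ }) = inj₂ (ℕ.≤-trans 0<x (ℕ.m≤m+n x (sum xs)))

mutual
  height≤area : ∀ {σ ℓ} (T : Tree σ ℓ) → height T ≤ area T
  height≤area {σ} {ℓ} (node r ts) with empty-or-positive (σ ℓ) r
  ... | inj₁ e = subst (_≤ objArea (σ ℓ) r ℕ.+ areaV ts) (sym (heightV-empty ts e)) z≤n
    where
    heightV-empty : ∀ {n} (ts : Vec (Tree σ (suc ℓ)) n) → n ≡ 0 → heightV ts ≡ 0
    heightV-empty [] _ = refl
  -- The positive area of the root's decoration covers the extra 1 in the bound for the children.
  ... | inj₂ p = ℕ.≤-trans (heightV≤area ts) (ℕ.+-monoˡ-≤ (areaV ts) p)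

  heightV≤area : ∀ {σ ℓ n} (ts : Vec (Tree σ ℓ) n) → heightV ts ≤ suc (areaV ts)
  heightV≤area []       = z≤n
  heightV≤area (t ∷ ts) = ℕ.⊔-lub
    (s≤s (ℕ.≤-trans (height≤area t) (ℕ.m≤m+n (area t) (areaV ts))))
    (ℕ.≤-trans (heightV≤area ts) (s≤s (ℕ.m≤n+m (areaV ts) (area t))))

count-bounded : ∀ N σ A → Count (xiSigma σ N A) (Σ (Tree σ 0) λ T → height T ≤ N × area T ≡ A)
count-bounded N σ A = Count-↔
  (mk↔ₛ′ (λ ((T , h) , p) → T , ℕ.≤-pred h , p) (λ (T , h , p) → (T , s≤s h) , p)
    (λ _ → refl) (λ { ((T , s≤s h) , p) → refl }))
  (count (Counted-Bounded N 0 σ λ _ → refl) A)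

count-trees : ∀ {ξ} → IsXi0 ξ → ∀ σ A → Count (ξ A) (Σ (Tree σ 0) λ T → area T ≡ A)
count-trees root σ A = Count-≡ (sym (root≡xiSigma root σ A)) (Count-↔
  (mk↔ₛ′ (λ (T , _ , p) → T , p) (λ (T , p) → T , subst (height T ≤_) p (height≤area T) , p)
    (λ _ → refl) (λ (T , h , p) → cong (λ h → T , h , p) (ℕ.≤-irrelevant _ h)))
  (count-bounded A σ A))

Count-unique : ∀ {z X Y} → Count z X → Count z Y → X ↔ Y
Count-unique (k , refl , i) (.k , refl , j) = ↔-trans (↔-sym i) j

theorem3 : (∀ (N : ℕ) (σ : ℕ → Bool) (A : ℕ) →
    Σ ℕ λ k → (xiSigma σ N A ≡ + k)
    × (Fin k ↔ Σ (Tree σ 0) (λ T → (height T ≤ N) × (area T ≡ A))))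
    × (∀ (ξ : Series) → IsXi0 ξ → ∀ (σ : ℕ → Bool) (A : ℕ) →
    Σ ℕ λ k → (ξ A ≡ + k) × (Fin k ↔ Σ (Tree σ 0) (λ T → area T ≡ A)))
    × (∀ (σ σ′ : ℕ → Bool) (A : ℕ) →
    Σ (Tree σ 0) (λ T → area T ≡ A) ↔ Σ (Tree σ′ 0) (λ T → area T ≡ A))
theorem3 = count-bounded
  , (λ ξ root → count-trees root)
  , λ σ σ′ A → Count-unique (count-trees xi0-root σ A) (count-trees xi0-root σ′ A)
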